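{- There is an absolute constant $C>0$ such that for all integers $n\ge 2$ and $q\ge 1$ the following holds. Let $G=(V,E)$ be an $n$-vertex directed graph with two special vertices $s,t\in V$, whose edge weights are univariate polynomials of the form $$\mathsf{wt}(e)=a_{e,q}\lambda^q+a_{e,q-1}\lambda^{q-1}+\cdots+a_{e,2}\lambda^2+a_{e,1}\lambda+a_{e,0},\qquad a_{e,i}\in\mathbb{R},$$ and let $S\subseteq\mathbb{R}$ be such that for every $x\in S$ the graph $G$ has no negative-weight directed cycle at $\lambda=x$. Then $$|\mathrm{MSPC}_S(G)|\le n^{C(\log n+\log q)},$$ that is, $|\mathrm{MSPC}_S(G)|\in n^{O(\log n+\log q)}$.
   Context: Graphs are simple (no multi-edges or self-loops) and connected, and there is at least one path from $s$ to $t$. Logarithms are to base 2. The parameter $\lambda\in\mathbb{R}$ is common to the entire graph, while the coefficients $a_{e,i}$ are fixed real constants for each edge. "At $\lambda=x$" refers to the fixed-edge-weight graph obtained by setting $\lambda=x$ in all edge weights. The weight of a path (or cycle) is the sum of the weights of its edges. Let $\mathcal{P}_{s,t}$ be the set of (simple) paths from $s$ to $t$ in $G$. For $S\subseteq\mathbb{R}$, $\mathrm{MSPC}_S(G)$ is a minimum-sized subset $\mathcal{S}\subseteq\mathcal{P}_{s,t}$ such that for every $x\in S$ some path in $\mathcal{S}$ is a shortest path from $s$ to $t$ in $G$ at $\lambda=x$; $|\mathrm{MSPC}_S(G)|$ denotes its size. When $S=\mathbb{R}$ (for instance, when $G$ is acyclic) one writes $\mathrm{MSPC}(G)$. -}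

module Defs where

open import Algebra.Bundles using (CommutativeRing)
import Algebra.Properties.Semiring.Exp as Exp
import Algebra.Properties.Semiring.Mult as Mult
import Algebra.Properties.Semiring.Sum as Sum
open import Axiom.ExcludedMiddle using (ExcludedMiddle)
open import Data.Bool using (Bool; T)
open import Data.Fin using (Fin; toℕ)
open import Data.List using (List; []; _∷_; length)
open import Data.List.Relation.Unary.All using (All)
open import Data.List.Relation.Unary.Any using (Any)
open import Data.List.Relation.Unary.Unique.Propositional using (Unique)
open import Data.Nat using (ℕ; suc; NonZero)
import Data.Nat as ℕ
open import Data.Product using (∃; _×_; _,_; proj₁)
open import Data.Vec.Functional using (Vector)
open import Level using (0ℓ)
open import Relation.Binary using (Rel; IsTotalOrder)
import Relation.Binary.Construct.NonStrictToStrict as NonStrictToStrict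
open import Relation.Binary.Construct.Closure.Equivalence using (EqClosure)
open import Relation.Binary.Construct.Closure.ReflexiveTransitive using (Star; ε; _◅_)
open import Relation.Nullary using (¬_; yes; no)
open import Relation.Unary using (Pred; Satisfiable; _∈_)

-- The real numbers, axiomatised as a Dedekind-complete ordered field;
-- classically this determines ℝ up to isomorphism.
record RealField : Set₁ where
  field
    commutativeRing : CommutativeRing 0ℓ 0ℓ

  open CommutativeRing commutativeRing public renaming (Carrier to ℝ)

  infix 4 _≤_
  field
    _≤_          : Rel ℝ 0ℓ
    isTotalOrder : IsTotalOrder _≈_ _≤_

  UpperBound : Pred ℝ 0ℓ → Pred ℝ 0ℓ
  UpperBound P u = ∀ x → x ∈ P → x ≤ u

  IsSupremum : Pred ℝ 0ℓ → Pred ℝ 0ℓ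
  IsSupremum P u = UpperBound P u × (∀ v → UpperBound P v → u ≤ v)

  field
    0≉1       : 0# ≉ 1#
    inverse   : ∀ x → x ≉ 0# → ∃ λ y → x * y ≈ 1#
    +-monoʳ-≤ : ∀ x {y z} → y ≤ z → x + y ≤ x + z
    *-nonNeg  : ∀ {x y} → 0# ≤ x → 0# ≤ y → 0# ≤ x * y
    complete  : ∀ P → Satisfiable P → Satisfiable (UpperBound P) →
                Satisfiable (IsSupremum P)

  open NonStrictToStrict _≈_ _≤_ public using (_<_)
  open Sum semiring public using (sum)
  open Exp semiring public using (_^_)

  ι : ℕ → ℝ
  ι n = n · 1#
    where open Mult semiring using () renaming (_×_ to _·_)

module Exponential (lem : ExcludedMiddle 0ℓ) (ℛ : RealField) where
  open RealField ℛ

  -- Total by convention: 0# if P is empty or not bounded above.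
  sup : Pred ℝ 0ℓ → ℝ
  sup P with lem {Satisfiable P × Satisfiable (UpperBound P)}
  ... | yes (nonempty , bounded) = proj₁ (complete P nonempty bounded)
  ... | no _ = 0#

  -- For b ≥ 1:  b ^ℝ y = sup { b^r ∣ r rational, r ≤ y }.  Here r = (k - l) / d,
  -- and z ≤ b^r is written without roots or negative exponents.
  infixr 8 _^ℝ_
  _^ℝ_ : ℝ → ℝ → ℝ
  b ^ℝ y = sup λ z → 0# ≤ z × ∃ λ k → ∃ λ l → ∃ λ d →
    NonZero d × ι k ≤ ι d * y + ι l × z ^ d * b ^ l ≤ b ^ k

  log₂ : ℝ → ℝ
  log₂ x = sup λ y → ι 2 ^ℝ y ≤ x

module ParametricGraph (ℛ : RealField) where
  open RealField ℛ

  -- Vector of coefficients a₀, …, a_q.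
  Poly : ℕ → Set
  Poly q = Vector ℝ (suc q)

  ⟦_⟧ : ∀ {q} → Poly q → ℝ → ℝ
  ⟦ a ⟧ x = sum λ i → a i * x ^ toℕ i

  -- Boolean adjacency excludes parallel edges; antiparallel pairs are allowed.
  record WeightedDigraph (n q : ℕ) : Set where
    field
      adjacent : Fin n → Fin n → Bool

    Edge : Rel (Fin n) 0ℓ
    Edge u v = T (adjacent u v)

    field
      loopless : ∀ v → ¬ Edge v v
      wt       : ∀ {u v} → Edge u v → Poly q

  module _ {n q : ℕ} (G : WeightedDigraph n q) where
    open WeightedDigraph G

    -- Connectivity of the underlying undirected graph.
    Connected : Set
    Connected = ∀ u v → EqClosure Edge u v

    Walk : Rel (Fin n) 0ℓ
    Walk = Star Edge

    vertices : ∀ {u v} → Walk u v → List (Fin n)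
    vertices {u} ε       = u ∷ []
    vertices {u} (_ ◅ p) = u ∷ vertices p

    IsPath : ∀ {u v} → Walk u v → Set
    IsPath p = Unique (vertices p)

    weight : ℝ → ∀ {u v} → Walk u v → ℝ
    weight x ε       = 0#
    weight x (e ◅ p) = ⟦ wt e ⟧ x + weight x p

    -- A directed cycle is an edge u → v followed by a path from v back to u.
    NoNegativeCycle : Pred ℝ 0ℓ
    NoNegativeCycle x = ∀ {u v} (e : Edge u v) (p : Walk v u) →
      IsPath p → ¬ (weight x (e ◅ p) < 0#)

    module _ (s t : Fin n) where

      IsShortestPath : ℝ → Pred (Walk s t) 0ℓ
      IsShortestPath x p = IsPath p × (∀ (p′ : Walk s t) → IsPath p′ → weight x p ≤ weight x p′)

      -- Finite sets of paths are duplicate-free lists, so `length` is cardinality.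
      record IsCover (S : Pred ℝ 0ℓ) (𝒮 : List (Walk s t)) : Set where
        field
          paths    : All IsPath 𝒮
          distinct : Unique 𝒮
          covers   : ∀ x → x ∈ S → Any (IsShortestPath x) 𝒮

      IsMSPC : Pred ℝ 0ℓ → Pred (List (Walk s t)) 0ℓ
      IsMSPC S 𝒮 = IsCover S 𝒮 × (∀ 𝒯 → IsCover S 𝒯 → length 𝒮 ℕ.≤ length 𝒯)

module Submission where

-- Cut the parameter line into cells such that, on each cell and for each pair
-- u, v, a single walk is lightest among all u-v walks of at most m edges.  A
-- lightest walk of at most 2m edges joins two such walks at a midpoint, so it is
-- one of n candidates; refining the cells by the at most q roots of the difference
-- of any two candidates makes the comparison constant on each cell.  Doubling m
-- therefore multiplies the number of cells by at most 1 + 2n⁴q ≤ n⁶q, and after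
-- about log n doublings every path is covered, for n^O(log n + log q) cells.
-- Without negative cycles, removing cycles turns the lightest walk of a cell into
-- a path that is shortest throughout the cell.

-- Comparing all paths pairwise would cut the line at the roots of exponentially many differences;
-- doubling keeps every comparison among n candidates for one pair of vertices in one cell. The
-- induction runs over walks because two joined paths need not form a path, and the bound on the
-- number of edges makes lightest walks exist even where cycles are negative. Negative cycles matter
-- only in the passage from walks to paths. A cell is a sign pattern relative to the breakpoints,
-- and each breakpoint forms a cell of its own, so l breakpoints give at most 2 l + 1 cells and ties
-- need no separate argument. A difference that vanishes identically fits the count as well: its
-- roots are divided out one at a time, and after q divisions the quotient is constant. The final
-- estimate rests on the exchange q^(log n) = n^(log q), carried out with powers of two above n and
-- q, so that real logarithms enter only through lower bounds by their integer floors.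

open import Defs
open import Algebra.Bundles using (CommutativeRing; RawRing)
import Algebra.Properties.AbelianGroup as AbelianGroupProperties
import Algebra.Properties.CommutativeSemigroup as CommutativeSemigroupProperties
import Algebra.Properties.Ring as RingProperties
import Algebra.Properties.Semiring.Exp as Exp
import Algebra.Properties.Semiring.Mult as Mult
import Algebra.Properties.Semiring.Sum as Sum
import Algebra.Solver.Ring as RingSolver
open import Algebra.Solver.Ring.AlmostCommutativeRing
  using (fromCommutativeRing; _-Raw-AlmostCommutative⟶_; Induced-equivalence)
open import Axiom.ExcludedMiddle using (ExcludedMiddle)
open import Data.Bool.Properties using (T?; T-irrelevant)
open import Data.Fin using (Fin; zero; suc; toℕ; fromℕ<)
import Data.Fin.Properties as Finₚ
open import Data.List as List using (List; []; _∷_; _++_; length)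
open import Data.List.Membership.Propositional using () renaming (_∈_ to _∈ᴸ_)
open import Data.List.Membership.Propositional.Properties using (∈-lookup)
import Data.List.Properties as Listₚ
open import Data.List.Relation.Binary.Subset.Propositional using (_⊆_)
open import Data.List.Relation.Binary.Subset.Propositional.Properties using (Any-resp-⊆; All-resp-⊇)
open import Data.List.Relation.Unary.All as All using (All; []; _∷_)
import Data.List.Relation.Unary.All.Properties as Allₚ
open import Data.List.Relation.Unary.AllPairs using ([]; _∷_)
open import Data.List.Relation.Unary.Any using (here; there)
import Data.List.Relation.Unary.Any.Properties as Anyₚ
open import Data.List.Relation.Unary.Unique.Propositional using (Unique)
open import Data.Maybe using (Maybe; just; nothing; zipWith)
open import Data.Nat using (ℕ; zero; suc; z≤n; s≤s; NonZero) renaming (_≤_ to _≤ᴺ_)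
import Data.Nat as ℕ
import Data.Nat.Properties as ℕₚ
open import Data.Nat.Solver using (module +-*-Solver)
open import Data.Product using (∃; _×_; _,_; proj₁; proj₂)
open import Data.Sum using (inj₁; inj₂)
open import Level using (0ℓ)
open import Relation.Binary using (Rel; IsTotalOrder; IsStrictTotalOrder; Poset; Tri; tri<; tri≈; tri>)
open import Relation.Binary.Construct.Closure.ReflexiveTransitive using (ε; _◅_; _◅◅_)
import Relation.Binary.Construct.NonStrictToStrict as NonStrictToStrict
open import Relation.Binary.Definitions using (WeaklyDecidable)
open import Relation.Binary.PropositionalEquality as ≡ using (_≡_)
import Relation.Binary.Reasoning.PartialOrder as ≤-Reasoning
import Relation.Binary.Reasoning.Setoid as ≈-Reasoning
open import Relation.Nullary using (¬_; yes; no; contradiction)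
open import Relation.Unary using (Pred; Satisfiable; _∈_)

-- Normalisation in commutative rings with integer coefficients.

-- The library's ring solver cancels x - x only if its coefficient ring has a
-- computing equality, so the coefficients are formal differences of naturals.
module IntegerSolver (R : CommutativeRing 0ℓ 0ℓ) where
  open CommutativeRing R hiding (zero)
  open Mult semiring using (×-homo-+; ×1-homo-*) renaming (_×_ to _·_)
  open RingProperties ring using ([y-z]x≈yx-zx; x[y-z]≈xy-xz; -0#≈0#)
  open AbelianGroupProperties +-abelianGroup using (⁻¹-∙-comm; ⁻¹-involutive)
  open CommutativeSemigroupProperties +-commutativeSemigroup using (interchange)
  open ≈-Reasoning setoid

  private
    ι : ℕ → Carrier
    ι n = n · 1#

    -- Normal form of the integer a - b, with at least one component zero. Equal integers then
    -- become equal pairs, so `_coeff≟_` can compare them componentwise.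
    reduce : ℕ → ℕ → ℕ × ℕ
    reduce (suc a) (suc b) = reduce a b
    reduce a       b       = a , b

    -- The first two clauses let :0 and :1 denote 0# and 1# on the nose.
    ⟦_⟧ : ℕ × ℕ → Carrier
    ⟦ 0 , 0 ⟧ = 0#
    ⟦ 1 , 0 ⟧ = 1#
    ⟦ a , b ⟧ = ι a - ι b

    -‿medial : ∀ w x y z → (w + x) - (y + z) ≈ (w - y) + (x - z)
    -‿medial w x y z = trans (+-congˡ (sym (⁻¹-∙-comm y z))) (interchange w x (- y) (- z))

    -‿swap : ∀ x y → - (x - y) ≈ y - x
    -‿swap x y = begin
      - (x - y)       ≈⟨ ⁻¹-∙-comm x (- y) ⟨
      - x + - (- y)   ≈⟨ +-congˡ (⁻¹-involutive y) ⟩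
      - x + y         ≈⟨ +-comm _ _ ⟩
      y - x           ∎

    ⟦⟧-difference : ∀ a b → ⟦ a , b ⟧ ≈ ι a - ι b
    ⟦⟧-difference 0             0       = sym (-‿inverseʳ 0#)
    ⟦⟧-difference 1             0       = sym (trans (+-cong (+-identityʳ 1#) -0#≈0#) (+-identityʳ 1#))
    ⟦⟧-difference (suc (suc a)) 0       = refl
    ⟦⟧-difference 0             (suc b) = refl
    ⟦⟧-difference 1             (suc b) = refl
    ⟦⟧-difference (suc (suc a)) (suc b) = refl

    ⟦reduce⟧ : ∀ a b → ⟦ reduce a b ⟧ ≈ ι a - ι b
    ⟦reduce⟧ zero    b       = ⟦⟧-difference zero b
    ⟦reduce⟧ (suc a) zero    = ⟦⟧-difference (suc a) zero
    ⟦reduce⟧ (suc a) (suc b) = begin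
      ⟦ reduce a b ⟧            ≈⟨ ⟦reduce⟧ a b ⟩
      ι a - ι b                 ≈⟨ +-identityˡ _ ⟨
      0# + (ι a - ι b)          ≈⟨ +-congʳ (-‿inverseʳ 1#) ⟨
      (1# - 1#) + (ι a - ι b)   ≈⟨ -‿medial 1# (ι a) 1# (ι b) ⟨
      (1# + ι a) - (1# + ι b)   ∎

    coefficients : RawRing 0ℓ 0ℓ
    coefficients = record
      { Carrier = ℕ × ℕ
      ; _≈_     = _≡_
      ; _+_     = λ { (a , b) (c , d) → reduce (a ℕ.+ c) (b ℕ.+ d) }
      ; _*_     = λ { (a , b) (c , d) → reduce (a ℕ.* c ℕ.+ b ℕ.* d) (b ℕ.* c ℕ.+ a ℕ.* d) }
      ; -_      = λ { (a , b) → b , a }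
      ; 0#      = 0 , 0
      ; 1#      = 1 , 0
      }

    open RawRing coefficients using () renaming (_+_ to _⊕_; _*_ to _⊗_)

    ⊕-homo : ∀ x y → ⟦ x ⊕ y ⟧ ≈ ⟦ x ⟧ + ⟦ y ⟧
    ⊕-homo (a , b) (c , d) = begin
      ⟦ reduce (a ℕ.+ c) (b ℕ.+ d) ⟧  ≈⟨ ⟦reduce⟧ (a ℕ.+ c) (b ℕ.+ d) ⟩
      ι (a ℕ.+ c) - ι (b ℕ.+ d)       ≈⟨ +-cong (×-homo-+ 1# a c) (-‿cong (×-homo-+ 1# b d)) ⟩
      (ι a + ι c) - (ι b + ι d)       ≈⟨ -‿medial (ι a) (ι c) (ι b) (ι d) ⟩
      (ι a - ι b) + (ι c - ι d)       ≈⟨ +-cong (⟦⟧-difference a b) (⟦⟧-difference c d) ⟨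
      ⟦ a , b ⟧ + ⟦ c , d ⟧           ∎

    ι-homo : ∀ a b c d → ι (a ℕ.* b ℕ.+ c ℕ.* d) ≈ ι a * ι b + ι c * ι d
    ι-homo a b c d = trans (×-homo-+ 1# (a ℕ.* b) (c ℕ.* d)) (+-cong (×1-homo-* a b) (×1-homo-* c d))

    ⊗-homo : ∀ x y → ⟦ x ⊗ y ⟧ ≈ ⟦ x ⟧ * ⟦ y ⟧
    ⊗-homo (a , b) (c , d) = begin
      ⟦ (a , b) ⊗ (c , d) ⟧
        ≈⟨ ⟦reduce⟧ (a ℕ.* c ℕ.+ b ℕ.* d) (b ℕ.* c ℕ.+ a ℕ.* d) ⟩
      ι (a ℕ.* c ℕ.+ b ℕ.* d) - ι (b ℕ.* c ℕ.+ a ℕ.* d)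
        ≈⟨ +-cong (ι-homo a c b d) (-‿cong (ι-homo b c a d)) ⟩
      (ι a * ι c + ι b * ι d) - (ι b * ι c + ι a * ι d)
        ≈⟨ -‿medial _ _ _ _ ⟩
      (ι a * ι c - ι b * ι c) + (ι b * ι d - ι a * ι d)
        ≈⟨ +-congˡ (-‿swap _ _) ⟨
      (ι a * ι c - ι b * ι c) - (ι a * ι d - ι b * ι d)
        ≈⟨ +-cong ([y-z]x≈yx-zx _ _ _) (-‿cong ([y-z]x≈yx-zx _ _ _)) ⟨
      (ι a - ι b) * ι c - (ι a - ι b) * ι d
        ≈⟨ x[y-z]≈xy-xz _ _ _ ⟨
      (ι a - ι b) * (ι c - ι d)
        ≈⟨ *-cong (⟦⟧-difference a b) (⟦⟧-difference c d) ⟨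
      ⟦ a , b ⟧ * ⟦ c , d ⟧ ∎

    -‿homo : ∀ x → ⟦ RawRing.-_ coefficients x ⟧ ≈ - ⟦ x ⟧
    -‿homo (a , b) = begin
      ⟦ b , a ⟧      ≈⟨ ⟦⟧-difference b a ⟩
      ι b - ι a      ≈⟨ -‿swap (ι a) (ι b) ⟨
      - (ι a - ι b)  ≈⟨ -‿cong (⟦⟧-difference a b) ⟨
      - ⟦ a , b ⟧    ∎

    morphism : coefficients -Raw-AlmostCommutative⟶ fromCommutativeRing R
    morphism = record
      { ⟦_⟧    = ⟦_⟧
      ; +-homo = ⊕-homo
      ; *-homo = ⊗-homo
      ; -‿homo = -‿homo
      ; 0-homo = refl
      ; 1-homo = refl
      }

    _coeff≟_ : WeaklyDecidable (Induced-equivalence morphism)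
    (a , b) coeff≟ (c , d) with a ℕₚ.≟ c | b ℕₚ.≟ d
    ... | yes ≡.refl | yes ≡.refl = just refl
    ... | _          | _          = nothing

  open RingSolver coefficients (fromCommutativeRing R) morphism _coeff≟_ public
    using (solve; con; _:=_; _:+_; _:*_; _:-_; :-_)

  :0 :1 : ∀ {n} → RingSolver.Polynomial coefficients (fromCommutativeRing R) morphism _coeff≟_ n
  :0 = con (0 , 0)
  :1 = con (1 , 0)

-- Order and signs in an ordered field.

module OrderedField (lem : ExcludedMiddle 0ℓ) (ℛ : RealField) where
  open RealField ℛ hiding (zero)
  open IntegerSolver commutativeRing
  open IsTotalOrder isTotalOrder public
    using (total; antisym; isPartialOrder; ≤-respˡ-≈; ≤-respʳ-≈)
    renaming (reflexive to ≤-reflexive; refl to ≤-refl; trans to ≤-trans)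
  open IsStrictTotalOrder (NonStrictToStrict.<-isStrictTotalOrder₁ _≈_ _≤_ (λ _ _ → lem) isTotalOrder) public
    using (compare; <-respˡ-≈; <-respʳ-≈)
    renaming (trans to <-trans)

  ≤-poset : Poset 0ℓ 0ℓ 0ℓ
  ≤-poset = record { isPartialOrder = isPartialOrder }

  open ≤-Reasoning ≤-poset

  <⇒≱ : ∀ {x y} → x < y → ¬ (y ≤ x)
  <⇒≱ = NonStrictToStrict.<⇒≱ _≈_ _≤_ antisym

  ≮⇒≥ : ∀ {x y} → ¬ (x < y) → y ≤ x
  ≮⇒≥ = NonStrictToStrict.≮⇒≥ _≈_ _≤_ sym (λ _ _ → lem) ≤-reflexive total

  <-≤-trans : ∀ {x y z} → x < y → y ≤ z → x < z
  <-≤-trans = NonStrictToStrict.<-≤-trans _≈_ _≤_ sym ≤-trans antisym ≤-respʳ-≈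

  ≤-<-trans : ∀ {x y z} → x ≤ y → y < z → x < z
  ≤-<-trans = NonStrictToStrict.≤-<-trans _≈_ _≤_ ≤-trans antisym ≤-respˡ-≈

  +-monoˡ-≤ : ∀ x {y z} → y ≤ z → y + x ≤ z + x
  +-monoˡ-≤ x {y} {z} y≤z = begin
    y + x  ≈⟨ +-comm y x ⟩
    x + y  ≤⟨ +-monoʳ-≤ x y≤z ⟩
    x + z  ≈⟨ +-comm x z ⟩
    z + x  ∎

  +-mono-≤ : ∀ {w x y z} → w ≤ x → y ≤ z → w + y ≤ x + z
  +-mono-≤ w≤x y≤z = ≤-trans (+-monoˡ-≤ _ w≤x) (+-monoʳ-≤ _ y≤z)

  x≤y⇒0≤y-x : ∀ {x y} → x ≤ y → 0# ≤ y - x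
  x≤y⇒0≤y-x {x} {y} x≤y = begin
    0#     ≈⟨ -‿inverseʳ x ⟨
    x - x  ≤⟨ +-monoˡ-≤ (- x) x≤y ⟩
    y - x  ∎

  0≤y-x⇒x≤y : ∀ {x y} → 0# ≤ y - x → x ≤ y
  0≤y-x⇒x≤y {x} {y} 0≤ = begin
    x            ≈⟨ +-identityʳ x ⟨
    x + 0#       ≤⟨ +-monoʳ-≤ x 0≤ ⟩
    x + (y - x)  ≈⟨ solve 2 (λ x y → x :+ (y :- x) := y) refl x y ⟩
    y            ∎

  x-y≈0⇒x≈y : ∀ {x y} → x - y ≈ 0# → x ≈ y
  x-y≈0⇒x≈y {x} {y} eq = trans (solve 2 (λ x y → x := (x :- y) :+ y) refl x y)
                               (trans (+-congʳ eq) (+-identityˡ y))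

  x≈y⇒x-y≈0 : ∀ {x y} → x ≈ y → x - y ≈ 0#
  x≈y⇒x-y≈0 {x} {y} eq = trans (+-congʳ eq) (-‿inverseʳ y)

  x<y⇒0<y-x : ∀ {x y} → x < y → 0# < y - x
  x<y⇒0<y-x (x≤y , x≉y) = x≤y⇒0≤y-x x≤y , λ eq → x≉y (sym (x-y≈0⇒x≈y (sym eq)))

  0<y-x⇒x<y : ∀ {x y} → 0# < y - x → x < y
  0<y-x⇒x<y (0≤ , 0≉) = 0≤y-x⇒x≤y 0≤ , λ eq → 0≉ (sym (x≈y⇒x-y≈0 (sym eq)))

  x<0⇒0<-x : ∀ {x} → x < 0# → 0# < - x
  x<0⇒0<-x x<0 = <-respʳ-≈ (+-identityˡ _) (x<y⇒0<y-x x<0)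

  0<-x⇒x<0 : ∀ {x} → 0# < - x → x < 0#
  0<-x⇒x<0 0<-x = 0<y-x⇒x<y (<-respʳ-≈ (sym (+-identityˡ _)) 0<-x)

  0<x⇒-x<0 : ∀ {x} → 0# < x → - x < 0#
  0<x⇒-x<0 {x} 0<x = 0<-x⇒x<0 (<-respʳ-≈ (solve 1 (λ x → x := :- (:- x)) refl x) 0<x)

  -x<0⇒0<x : ∀ {x} → - x < 0# → 0# < x
  -x<0⇒0<x {x} -x<0 = <-respʳ-≈ (solve 1 (λ x → :- (:- x) := x) refl x) (x<0⇒0<-x -x<0)

  *-monoʳ-≤ : ∀ {c x y} → 0# ≤ c → x ≤ y → c * x ≤ c * y
  *-monoʳ-≤ {c} {x} {y} 0≤c x≤y = 0≤y-x⇒x≤y (begin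
    0#             ≤⟨ *-nonNeg 0≤c (x≤y⇒0≤y-x x≤y) ⟩
    c * (y - x)    ≈⟨ solve 3 (λ c x y → c :* (y :- x) := c :* y :- c :* x) refl c x y ⟩
    c * y - c * x  ∎)

  *-mono-≤ : ∀ {w x y z} → 0# ≤ w → 0# ≤ y → w ≤ x → y ≤ z → w * y ≤ x * z
  *-mono-≤ {w} {x} {y} {z} 0≤w 0≤y w≤x y≤z = begin
    w * y  ≈⟨ *-comm w y ⟩
    y * w  ≤⟨ *-monoʳ-≤ 0≤y w≤x ⟩
    y * x  ≈⟨ *-comm y x ⟩
    x * y  ≤⟨ *-monoʳ-≤ (≤-trans 0≤w w≤x) y≤z ⟩
    x * z  ∎

  *-cancelˡ-0 : ∀ {x y} → x ≉ 0# → x * y ≈ 0# → y ≈ 0#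
  *-cancelˡ-0 {x} {y} x≉0 xy≈0 with inverse x x≉0
  ... | x⁻¹ , xx⁻¹≈1 = begin-equality
    y                ≈⟨ *-identityˡ y ⟨
    1# * y           ≈⟨ *-congʳ xx⁻¹≈1 ⟨
    (x * x⁻¹) * y    ≈⟨ solve 3 (λ x i y → (x :* i) :* y := i :* (x :* y)) refl x x⁻¹ y ⟩
    x⁻¹ * (x * y)    ≈⟨ *-congˡ xy≈0 ⟩
    x⁻¹ * 0#         ≈⟨ zeroʳ x⁻¹ ⟩
    0#               ∎

  *-pos : ∀ {x y} → 0# < x → 0# < y → 0# < x * y
  *-pos (0≤x , 0≉x) (0≤y , 0≉y) =
    *-nonNeg 0≤x 0≤y , λ eq → 0≉y (sym (*-cancelˡ-0 (λ x≈0 → 0≉x (sym x≈0)) (sym eq)))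

  -- Squares are nonnegative: if 1 ≤ 0, then 0 ≤ -1, and its square 1 is nonnegative after all,
  -- which would identify 0 and 1.
  0<1 : 0# < 1#
  0<1 with total 0# 1#
  ... | inj₁ 0≤1 = 0≤1 , 0≉1
  ... | inj₂ 1≤0 = contradiction (antisym 0≤1 1≤0) 0≉1
    where
    0≤-1 : 0# ≤ - 1#
    0≤-1 = ≤-respʳ-≈ (+-identityˡ (- 1#)) (x≤y⇒0≤y-x 1≤0)
    0≤1 : 0# ≤ 1#
    0≤1 = begin
      0#           ≤⟨ *-nonNeg 0≤-1 0≤-1 ⟩
      - 1# * - 1#  ≈⟨ solve 0 (:- :1 :* :- :1 := :1) refl ⟩
      1#           ∎

  x<x+1 : ∀ x → x < x + 1#
  x<x+1 x = 0<y-x⇒x<y (<-respʳ-≈ (solve 1 (λ x → :1 := (x :+ :1) :- x) refl x) 0<1)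

  inverse-pos : ∀ {x} → 0# < x → ∃ λ y → 0# < y × x * y ≈ 1#
  inverse-pos {x} 0<x with inverse x (λ x≈0 → proj₂ 0<x (sym x≈0))
  ... | y , xy≈1 with compare 0# y
  ...   | tri< 0<y _ _ = y , 0<y , xy≈1
  ...   | tri≈ _ 0≈y _ = contradiction (trans (sym (trans (*-congˡ (sym 0≈y)) (zeroʳ x))) xy≈1) 0≉1
  ...   | tri> _ _ y<0 = contradiction (begin
    1#              ≈⟨ xy≈1 ⟨
    x * y           ≤⟨ *-monoʳ-≤ (proj₁ 0<x) (proj₁ y<0) ⟩
    x * 0#          ≈⟨ zeroʳ x ⟩
    0#              ∎) (<⇒≱ 0<1)

  bounded-above : ∀ x → ∃ λ m → 0# ≤ m × x ≤ m
  bounded-above x with total 0# x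
  ... | inj₁ 0≤x = x , 0≤x , ≤-refl
  ... | inj₂ x≤0 = 0# , ≤-refl , x≤0

  minimum : ∀ {x y} → 0# < x → 0# < y → ∃ λ z → 0# < z × z ≤ x × z ≤ y
  minimum {x} {y} 0<x 0<y with total x y
  ... | inj₁ x≤y = x , 0<x , ≤-refl , x≤y
  ... | inj₂ y≤x = y , 0<y , y≤x , ≤-refl

  -- Zero is a class of its own, so that the relation passes to products (`SameSign-*`): equal signs
  -- of the linear factors then give equal signs of the polynomial.
  data SameSign (x y : ℝ) : Set where
    negative : x < 0# → y < 0# → SameSign x y
    null     : x ≈ 0# → y ≈ 0# → SameSign x y
    positive : 0# < x → 0# < y → SameSign x y

  SameSign-sym : ∀ {x y} → SameSign x y → SameSign y x
  SameSign-sym (negative a b) = negative b a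
  SameSign-sym (null a b)     = null b a
  SameSign-sym (positive a b) = positive b a

  SameSign-resp-≈ : ∀ {x x′ y y′} → x ≈ x′ → y ≈ y′ → SameSign x y → SameSign x′ y′
  SameSign-resp-≈ p q (negative a b) = negative (<-respˡ-≈ p a) (<-respˡ-≈ q b)
  SameSign-resp-≈ p q (null a b)     = null (trans (sym p) a) (trans (sym q) b)
  SameSign-resp-≈ p q (positive a b) = positive (<-respʳ-≈ p a) (<-respʳ-≈ q b)

  SameSign-refl : ∀ {x} → SameSign x x
  SameSign-refl {x} with compare x 0#
  ... | tri< a _ _ = negative a a
  ... | tri≈ _ a _ = null a a
  ... | tri> _ _ a = positive a a

  SameSign-nonNeg : ∀ {x y} → SameSign x y → 0# ≤ x → 0# ≤ y
  SameSign-nonNeg (negative a _) 0≤x = contradiction 0≤x (<⇒≱ a)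
  SameSign-nonNeg (null _ b)     _   = ≤-reflexive (sym b)
  SameSign-nonNeg (positive _ b) _   = proj₁ b

  neg-*-neg : ∀ {x y} → x < 0# → y < 0# → 0# < x * y
  neg-*-neg {x} {y} x<0 y<0 =
    <-respʳ-≈ (solve 2 (λ x y → :- x :* :- y := x :* y) refl x y) (*-pos (x<0⇒0<-x x<0) (x<0⇒0<-x y<0))

  neg-*-pos : ∀ {x y} → x < 0# → 0# < y → x * y < 0#
  neg-*-pos {x} {y} x<0 0<y =
    0<-x⇒x<0 (<-respʳ-≈ (solve 2 (λ x y → :- x :* y := :- (x :* y)) refl x y) (*-pos (x<0⇒0<-x x<0) 0<y))

  pos-*-neg : ∀ {x y} → 0# < x → y < 0# → x * y < 0#
  pos-*-neg {x} {y} 0<x y<0 = <-respˡ-≈ (*-comm y x) (neg-*-pos y<0 0<x)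

  SameSign-* : ∀ {x x′ y y′} → SameSign x x′ → SameSign y y′ → SameSign (x * y) (x′ * y′)
  SameSign-* (null a b)     _              = null (trans (*-congʳ a) (zeroˡ _)) (trans (*-congʳ b) (zeroˡ _))
  SameSign-* _              (null a b)     = null (trans (*-congˡ a) (zeroʳ _)) (trans (*-congˡ b) (zeroʳ _))
  SameSign-* (negative a b) (negative c d) = positive (neg-*-neg a c) (neg-*-neg b d)
  SameSign-* (negative a b) (positive c d) = negative (neg-*-pos a c) (neg-*-pos b d)
  SameSign-* (positive a b) (negative c d) = negative (pos-*-neg a c) (pos-*-neg b d)
  SameSign-* (positive a b) (positive c d) = positive (*-pos a c) (*-pos b d)

-- Polynomial functions: division by a linear factor and the intermediate value theorem.

module PolynomialFunctions (lem : ExcludedMiddle 0ℓ) (ℛ : RealField) where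
  open RealField ℛ hiding (zero)
  open IntegerSolver commutativeRing
  open OrderedField lem ℛ
  open ≤-Reasoning ≤-poset

  -- Polynomial functions of degree at most q, in Horner form.
  Deg : ℕ → (ℝ → ℝ) → Set
  Deg zero    f = ∃ λ c → ∀ x → f x ≈ c
  Deg (suc q) f = ∃ λ c → ∃ λ g → Deg q g × ∀ x → f x ≈ c + x * g x

  Deg-resp : ∀ q {f g} → (∀ x → g x ≈ f x) → Deg q f → Deg q g
  Deg-resp zero    g≈f (c , eq)          = c , λ x → trans (g≈f x) (eq x)
  Deg-resp (suc q) g≈f (c , h , Dh , eq) = c , h , Dh , λ x → trans (g≈f x) (eq x)

  Deg-const : ∀ q c → Deg q (λ _ → c)
  Deg-const zero    c = c , λ _ → refl
  Deg-const (suc q) c = c , (λ _ → 0#) , Deg-const q 0# ,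
    λ x → solve 2 (λ c x → c := c :+ x :* :0) refl c x

  Deg-+ : ∀ q {f g} → Deg q f → Deg q g → Deg q (λ x → f x + g x)
  Deg-+ zero    (c , p)          (d , r)           = c + d , λ x → +-cong (p x) (r x)
  Deg-+ (suc q) (c , f , Df , p) (d , g , Dg , r) =
    c + d , _ , Deg-+ q Df Dg , λ x → trans (+-cong (p x) (r x))
      (solve 5 (λ c d x f g → (c :+ x :* f) :+ (d :+ x :* g) := (c :+ d) :+ x :* (f :+ g)) refl c d x (f x) (g x))

  Deg-scale : ∀ q {f} a → Deg q f → Deg q (λ x → a * f x)
  Deg-scale zero    a (c , p)          = a * c , λ x → *-congˡ (p x)
  Deg-scale (suc q) a (c , f , Df , p) =
    a * c , _ , Deg-scale q a Df , λ x → trans (*-congˡ (p x))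
      (solve 4 (λ a c x f → a :* (c :+ x :* f) := a :* c :+ x :* (a :* f)) refl a c x (f x))

  Deg-neg : ∀ q {f} → Deg q f → Deg q (λ x → - f x)
  Deg-neg q {f} Df = Deg-resp q (λ x → solve 1 (λ y → :- y := :- :1 :* y) refl (f x)) (Deg-scale q (- 1#) Df)

  Deg-weaken : ∀ q {f} → Deg q f → Deg (suc q) f
  Deg-weaken zero    (c , p)          = Deg-resp 1 p (Deg-const 1 c)
  Deg-weaken (suc q) (c , f , Df , p) = c , f , Deg-weaken q Df , p

  Deg-affine : ∀ q {f} a b → Deg q f → Deg q (λ x → f (a + b * x))
  Deg-affine zero    a b (c , p)          = c , λ x → p (a + b * x)
  Deg-affine (suc q) a b (c , f , Df , p) =
    Deg-resp (suc q)
      (λ x → trans (p (a + b * x))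
        (solve 5 (λ a b c x f → c :+ (a :+ b :* x) :* f := (c :+ x :* (b :* f)) :+ a :* f)
          refl a b c x (f (a + b * x))))
      (Deg-+ (suc q) (c , _ , Deg-scale q b Df∘ , λ x → refl) (Deg-weaken q (Deg-scale q a Df∘)))
    where
    Df∘ : Deg q (λ x → f (a + b * x))
    Df∘ = Deg-affine q a b Df

  -- With f = c + x g, write x g = r g + (x - r) g and divide g by x - r, with quotient h, in the
  -- first summand only; the quotient of f is then g + r h.
  Deg-divide : ∀ q {f} r → Deg (suc q) f → ∃ λ h → Deg q h × ∀ x → f x ≈ f r + (x - r) * h x
  Deg-divide zero {f} r (c , g , (d , g≈d) , p) = (λ _ → d) , (d , λ _ → refl) , λ x → begin-equality
    f x                      ≈⟨ p x ⟩
    c + x * g x              ≈⟨ +-congˡ (*-congˡ (g≈d x)) ⟩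
    c + x * d                ≈⟨ solve 4 (λ c d x r → c :+ x :* d := (c :+ r :* d) :+ (x :- r) :* d) refl c d x r ⟩
    (c + r * d) + (x - r) * d  ≈⟨ +-congʳ (+-congˡ (*-congˡ (g≈d r))) ⟨
    (c + r * g r) + (x - r) * d  ≈⟨ +-congʳ (p r) ⟨
    f r + (x - r) * d        ∎
  Deg-divide (suc q) {f} r (c , g , Dg , p) with Deg-divide q r Dg
  ... | h , Dh , g≈ = (λ x → g x + r * h x) , Deg-+ (suc q) Dg (Deg-weaken q (Deg-scale q r Dh)) , λ x → begin-equality
    f x                                    ≈⟨ p x ⟩
    c + x * g x                            ≈⟨ solve 4 (λ c x r g → c :+ x :* g := c :+ (r :* g :+ (x :- r) :* g)) refl c x r (g x) ⟩
    c + (r * g x + (x - r) * g x)          ≈⟨ +-congˡ (+-congʳ (*-congˡ (g≈ x))) ⟩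
    c + (r * (g r + (x - r) * h x) + (x - r) * g x)
      ≈⟨ solve 6 (λ c x r u v w → c :+ (r :* (u :+ (x :- r) :* v) :+ (x :- r) :* w)
                               := (c :+ r :* u) :+ (x :- r) :* (w :+ r :* v)) refl c x r (g r) (h x) (g x) ⟩
    (c + r * g r) + (x - r) * (g x + r * h x) ≈⟨ +-congʳ (p r) ⟨
    f r + (x - r) * (g x + r * h x)        ∎

  Deg-bounded : ∀ q {f} → Deg q f → ∃ λ m → 0# ≤ m × ∀ t → 0# ≤ t → t ≤ 1# → f t ≤ m
  Deg-bounded zero (c , p) with bounded-above c
  ... | m , 0≤m , c≤m = m , 0≤m , λ t _ _ → ≤-respˡ-≈ (sym (p t)) c≤m
  Deg-bounded (suc q) {f} (c , g , Dg , p) with bounded-above c | Deg-bounded q Dg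
  ... | m , 0≤m , c≤m | k , 0≤k , g≤k = m + k , ≤-respˡ-≈ (+-identityˡ 0#) (+-mono-≤ 0≤m 0≤k) , λ t 0≤t t≤1 → begin
    f t          ≈⟨ p t ⟩
    c + t * g t  ≤⟨ +-mono-≤ c≤m (*-monoʳ-≤ 0≤t (g≤k t 0≤t t≤1)) ⟩
    m + t * k    ≤⟨ +-monoʳ-≤ m (*-mono-≤ 0≤t 0≤k t≤1 ≤-refl) ⟩
    m + 1# * k   ≈⟨ +-congˡ (*-identityˡ k) ⟩
    m + k        ∎

  -- One-sided continuity at 0: f t = c + t (g t) ≤ c + t m on [0, 1], where c = f 0 is negative, so
  -- a small enough t cannot make up for c.
  Deg-neg-near-0 : ∀ q {f} → Deg q f → f 0# < 0# → ∃ λ δ → 0# < δ × ∀ t → 0# ≤ t → t ≤ δ → f t < 0#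
  Deg-neg-near-0 zero    (c , p) f0<0 =
    1# , 0<1 , λ t _ _ → <-respˡ-≈ (trans (p 0#) (sym (p t))) f0<0
  Deg-neg-near-0 (suc q) {f} (c , g , Dg , p) f0<0 with Deg-bounded q Dg
  ... | m , 0≤m , g≤m = δ , *-pos 0<e 0<i , below
    where
    f0≈c : f 0# ≈ c
    f0≈c = trans (p 0#) (solve 2 (λ c g → c :+ :0 :* g := c) refl c (g 0#))
    e d : ℝ
    e = - c
    0<e : 0# < e
    0<e = x<0⇒0<-x (<-respˡ-≈ f0≈c f0<0)
    -- The summand e keeps δ = e / d at most 1, where the bound m applies; the summand 1 helps to
    -- leave c + δ m = -δ (1 + e), which is strictly negative.
    d = (m + e) + 1#
    e≤d : e ≤ d
    e≤d = begin
      e       ≈⟨ +-identityˡ e ⟨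
      0# + e  ≤⟨ +-monoˡ-≤ e 0≤m ⟩
      m + e   <⟨ x<x+1 _ ⟩
      d       ∎
    inv : ∃ λ i → 0# < i × d * i ≈ 1#
    inv = inverse-pos (<-≤-trans 0<e e≤d)
    i δ : ℝ
    i = proj₁ inv
    0<i : 0# < i
    0<i = proj₁ (proj₂ inv)
    δ = e * i
    δ≤1 : δ ≤ 1#
    δ≤1 = begin
      e * i  ≤⟨ *-mono-≤ (proj₁ 0<e) (proj₁ 0<i) e≤d ≤-refl ⟩
      d * i  ≈⟨ proj₂ (proj₂ inv) ⟩
      1#     ∎
    below : ∀ t → 0# ≤ t → t ≤ δ → f t < 0#
    below t 0≤t t≤δ = begin-strict
      f t                ≈⟨ p t ⟩
      c + t * g t        ≤⟨ +-monoʳ-≤ c (*-monoʳ-≤ 0≤t (g≤m t 0≤t (≤-trans t≤δ δ≤1))) ⟩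
      c + t * m          ≤⟨ +-monoʳ-≤ c (*-mono-≤ 0≤t 0≤m t≤δ ≤-refl) ⟩
      c + (e * i) * m
        ≈⟨ solve 3 (λ c i m → c :+ (:- c :* i) :* m
                           := (c :+ :- c :* (((m :- c) :+ :1) :* i)) :+ (:- (:- c :* i)) :* (:1 :- c)) refl c i m ⟩
      (c + e * (d * i)) + (- δ) * (1# + e)
        ≈⟨ +-congʳ (+-congˡ (*-congˡ (proj₂ (proj₂ inv)))) ⟩
      (c + e * 1#) + (- δ) * (1# + e)
        ≈⟨ solve 2 (λ c y → (c :+ :- c :* :1) :+ y := y) refl c _ ⟩
      (- δ) * (1# + e)
        <⟨ neg-*-pos (0<x⇒-x<0 (*-pos 0<e 0<i))
                     (<-respʳ-≈ (+-comm e 1#) (<-trans 0<e (x<x+1 e))) ⟩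
      0# ∎

  Deg-cong : ∀ q {f} → Deg q f → ∀ {x y} → x ≈ y → f x ≈ f y
  Deg-cong zero    (c , p)          eq = trans (p _) (sym (p _))
  Deg-cong (suc q) (c , g , Dg , p) eq = trans (p _) (trans (+-congˡ (*-cong eq (Deg-cong q Dg eq))) (sym (p _)))

  -- σ = 1 and σ = -1 give the right and the left neighbourhood of s.
  Deg-neg-near : ∀ q {f} → Deg q f → ∀ s σ → f s < 0# →
                 ∃ λ δ → 0# < δ × ∀ t → 0# ≤ t → t ≤ δ → f (s + σ * t) < 0#
  Deg-neg-near q Df s σ fs<0 = Deg-neg-near-0 q (Deg-affine q s σ Df)
    (<-respˡ-≈ (Deg-cong q Df (solve 2 (λ s σ → s := s :+ σ :* :0) refl s σ)) fs<0)

  module _ q {f : ℝ → ℝ} (Df : Deg q f) {b s : ℝ} (sup : IsSupremum (λ x → x ≤ b × f x ≤ 0#) s) where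

    -- A negative value at s would persist a little to the right. Since f b is positive, s < b, so
    -- some point beyond s would still lie in the set.
    sup-not-negative : 0# < f b → ¬ (f s < 0#)
    sup-not-negative 0<fb fs<0 with Deg-neg-near q Df s 1# fs<0
    ... | η , 0<η , below with minimum 0<η (x<y⇒0<y-x s<b)
      where
      s<b : s < b
      s<b = proj₂ sup b (λ _ → proj₁) , λ s≈b → <⇒≱ 0<fb (proj₁ (<-respˡ-≈ (Deg-cong q Df s≈b) fs<0))
    ...   | δ , 0<δ , δ≤η , δ≤b-s = <⇒≱ s<s+δ (proj₁ sup (s + 1# * δ) (s+δ≤b , proj₁ (below δ (proj₁ 0<δ) δ≤η)))
      where
      s+δ≤b : s + 1# * δ ≤ b
      s+δ≤b = begin
        s + 1# * δ   ≈⟨ +-congˡ (*-identityˡ δ) ⟩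
        s + δ        ≤⟨ +-monoʳ-≤ s δ≤b-s ⟩
        s + (b - s)  ≈⟨ solve 2 (λ s b → s :+ (b :- s) := b) refl s b ⟩
        b            ∎
      s<s+δ : s < s + 1# * δ
      s<s+δ = 0<y-x⇒x<y (<-respʳ-≈ (solve 2 (λ s δ → δ := (s :+ :1 :* δ) :- s) refl s δ) 0<δ)

    -- A positive value at s would persist on some interval [s - δ, s], so s - δ would already be an
    -- upper bound.
    sup-not-positive : ¬ (0# < f s)
    sup-not-positive 0<fs with Deg-neg-near q (Deg-neg q Df) s (- 1#) (0<x⇒-x<0 0<fs)
    ... | δ , 0<δ , below = <⇒≱ s-δ<s (proj₂ sup (s - δ) s-δ-upper)
      where
      s-δ<s : s - δ < s
      s-δ<s = 0<y-x⇒x<y (<-respʳ-≈ (solve 2 (λ s δ → δ := s :- (s :- δ)) refl s δ) 0<δ)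
      s-δ-upper : ∀ x → x ≤ b × f x ≤ 0# → x ≤ s - δ
      s-δ-upper x x∈P with total x (s - δ)
      ... | inj₁ x≤s-δ = x≤s-δ
      ... | inj₂ s-δ≤x = contradiction (proj₂ x∈P) (<⇒≱ (<-respʳ-≈ (Deg-cong q Df s-[s-x]≈x) 0<f[s-[s-x]]))
        where
        s-x≤δ : s - x ≤ δ
        s-x≤δ = 0≤y-x⇒x≤y (≤-respʳ-≈ (solve 3 (λ x s δ → x :- (s :- δ) := δ :- (s :- x)) refl x s δ) (x≤y⇒0≤y-x s-δ≤x))
        s-[s-x]≈x : s + - 1# * (s - x) ≈ x
        s-[s-x]≈x = solve 2 (λ s x → s :+ :- :1 :* (s :- x) := x) refl s x
        0<f[s-[s-x]] : 0# < f (s + - 1# * (s - x))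
        0<f[s-[s-x]] = -x<0⇒0<x (below (s - x) (x≤y⇒0≤y-x (proj₁ sup x x∈P)) s-x≤δ)

  intermediate-value : ∀ q {f} → Deg q f → ∀ {a b} → a ≤ b → f a < 0# → 0# < f b → ∃ λ r → f r ≈ 0#
  intermediate-value q {f} Df {a} {b} a≤b fa<0 0<fb = proj₁ supremum , fs≈0 (compare (f (proj₁ supremum)) 0#)
    where
    supremum : Satisfiable (IsSupremum (λ x → x ≤ b × f x ≤ 0#))
    supremum = complete _ (a , a≤b , proj₁ fa<0) (b , λ _ → proj₁)
    fs≈0 : Tri (f (proj₁ supremum) < 0#) (f (proj₁ supremum) ≈ 0#) (0# < f (proj₁ supremum)) → f (proj₁ supremum) ≈ 0#
    fs≈0 (tri< fs<0 _ _) = contradiction fs<0 (sup-not-negative q Df (proj₂ supremum) 0<fb)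
    fs≈0 (tri≈ _ fs≈0 _) = fs≈0
    fs≈0 (tri> _ _ 0<fs) = contradiction 0<fs (sup-not-positive q Df (proj₂ supremum))

  intermediate-value-decreasing : ∀ q {f} → Deg q f → ∀ {a b} → a ≤ b → 0# < f a → f b < 0# → ∃ λ r → f r ≈ 0#
  intermediate-value-decreasing q {f} Df a≤b 0<fa fb<0 =
    proj₁ root , trans (solve 1 (λ x → x := :- :1 :* :- x) refl (f (proj₁ root))) (trans (*-congˡ (proj₂ root)) (zeroʳ _))
    where
    root : ∃ λ r → - f r ≈ 0#
    root = intermediate-value q (Deg-neg q Df) a≤b (0<x⇒-x<0 0<fa) (x<0⇒0<-x fb<0)

  rootless-SameSign : ∀ q {f} → Deg q f → ¬ (∃ λ r → f r ≈ 0#) → ∀ x y → SameSign (f x) (f y)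
  rootless-SameSign q {f} Df rootless x y with compare (f x) 0# | compare (f y) 0# | total x y
  ... | tri≈ _ fx≈0 _ | _             | _ = contradiction (x , fx≈0) rootless
  ... | tri< _ _ _    | tri≈ _ fy≈0 _ | _ = contradiction (y , fy≈0) rootless
  ... | tri> _ _ _    | tri≈ _ fy≈0 _ | _ = contradiction (y , fy≈0) rootless
  ... | tri< fx<0 _ _ | tri< fy<0 _ _ | _ = negative fx<0 fy<0
  ... | tri> _ _ 0<fx | tri> _ _ 0<fy | _ = positive 0<fx 0<fy
  ... | tri< fx<0 _ _ | tri> _ _ 0<fy | inj₁ x≤y = contradiction (intermediate-value q Df x≤y fx<0 0<fy) rootless
  ... | tri< fx<0 _ _ | tri> _ _ 0<fy | inj₂ y≤x = contradiction (intermediate-value-decreasing q Df y≤x 0<fy fx<0) rootless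
  ... | tri> _ _ 0<fx | tri< fy<0 _ _ | inj₁ x≤y = contradiction (intermediate-value-decreasing q Df x≤y 0<fx fy<0) rootless
  ... | tri> _ _ 0<fx | tri< fy<0 _ _ | inj₂ y≤x = contradiction (intermediate-value q Df y≤x fy<0 0<fx) rootless

-- Breakpoints and the cells they cut out of the parameter line.

module Breakpoints (lem : ExcludedMiddle 0ℓ) (ℛ : RealField) where
  open RealField ℛ hiding (zero)
  open OrderedField lem ℛ
  open PolynomialFunctions lem ℛ

  Indistinguishable : List ℝ → Rel ℝ 0ℓ
  Indistinguishable L x y = All (λ r → SameSign (x - r) (y - r)) L

  -- Keeping the budget b next to the relation makes the count of breakpoints compositional:
  -- conjunctions and finite quantifiers just add budgets.
  Determined : ℕ → Rel ℝ 0ℓ → Set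
  Determined b R = ∃ λ L → length L ℕ.≤ b × (∀ {x y} → Indistinguishable L x y → R x y)

  Determined-trivial : ∀ b {R} → (∀ {x y} → R x y) → Determined b R
  Determined-trivial b r = [] , z≤n , λ _ → r

  Determined-∩ : ∀ {b c R Q} → Determined b R → Determined c Q → Determined (b ℕ.+ c) (λ x y → R x y × Q x y)
  Determined-∩ (L , L≤b , f) (M , M≤c , g) =
    L ++ M , ≡.subst (ℕ._≤ _) (≡.sym (Listₚ.length-++ L)) (ℕₚ.+-mono-≤ L≤b M≤c) ,
    λ xy → f (Allₚ.++⁻ˡ L xy) , g (Allₚ.++⁻ʳ L xy)

  Determined-∀ : ∀ n {b} {R : Fin n → Rel ℝ 0ℓ} → (∀ i → Determined b (R i)) →
                 Determined (n ℕ.* b) (λ x y → ∀ i → R i x y)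
  Determined-∀ zero    D = Determined-trivial 0 λ ()
  Determined-∀ (suc n) D with Determined-∩ (D zero) (Determined-∀ n (λ i → D (suc i)))
  ... | L , L≤ , f = L , L≤ , λ { xy zero → proj₁ (f xy) ; xy (suc i) → proj₂ (f xy) i }

  -- Either f has no root and IVT applies, or a root r is a breakpoint and f = (x - r) h.
  Deg-SameSign-determined : ∀ q {f} → Deg q f → Determined q (λ x y → SameSign (f x) (f y))
  Deg-SameSign-determined zero    (c , p) =
    Determined-trivial 0 λ {x} {y} → SameSign-resp-≈ (sym (p x)) (sym (p y)) SameSign-refl
  Deg-SameSign-determined (suc q) {f} Df with lem {∃ λ r → f r ≈ 0#}
  ... | no rootless = Determined-trivial (suc q) λ {x} {y} → rootless-SameSign (suc q) Df rootless x y
  ... | yes (r , fr≈0) with Deg-divide q r Df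
  ...   | h , Dh , f≈ with Deg-SameSign-determined q Dh
  ...     | L , L≤q , same = r ∷ L , s≤s L≤q , λ { (xy-r ∷ xy) →
            SameSign-resp-≈ (sym (factor _)) (sym (factor _)) (SameSign-* xy-r (same xy)) }
    where
    factor : ∀ x → f x ≈ (x - r) * h x
    factor x = trans (f≈ x) (trans (+-congʳ fr≈0) (+-identityˡ _))

  sgn : ℝ → ℕ
  sgn x with compare x 0#
  ... | tri< _ _ _ = 0
  ... | tri≈ _ _ _ = 1
  ... | tri> _ _ _ = 2

  sgn≤2 : ∀ x → sgn x ℕ.≤ 2
  sgn≤2 x with compare x 0#
  ... | tri< _ _ _ = z≤n
  ... | tri≈ _ _ _ = s≤s z≤n
  ... | tri> _ _ _ = ℕₚ.≤-refl

  sgn-mono : ∀ {x y} → x ≤ y → sgn x ℕ.≤ sgn y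
  sgn-mono {x} {y} x≤y with compare x 0# | compare y 0#
  ... | tri< _ _ _   | _            = z≤n
  ... | tri≈ _ _ _   | tri≈ _ _ _   = ℕₚ.≤-refl
  ... | tri≈ _ _ _   | tri> _ _ _   = s≤s z≤n
  ... | tri> _ _ _   | tri> _ _ _   = ℕₚ.≤-refl
  ... | tri≈ _ x≈0 _ | tri< y<0 _ _ = contradiction (≤-respˡ-≈ x≈0 x≤y) (<⇒≱ y<0)
  ... | tri> _ _ 0<x | tri< y<0 _ _ = contradiction x≤y (<⇒≱ (<-trans y<0 0<x))
  ... | tri> _ _ 0<x | tri≈ _ y≈0 _ = contradiction (≤-respʳ-≈ y≈0 x≤y) (<⇒≱ 0<x)

  sgn-injective : ∀ {x y} → sgn x ≡ sgn y → SameSign x y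
  sgn-injective {x} {y} eq with compare x 0# | compare y 0#
  ... | tri< x<0 _ _ | tri< y<0 _ _ = negative x<0 y<0
  ... | tri≈ _ x≈0 _ | tri≈ _ y≈0 _ = null x≈0 y≈0
  ... | tri> _ _ 0<x | tri> _ _ 0<y = positive 0<x 0<y
  sgn-injective () | tri< _ _ _ | tri≈ _ _ _
  sgn-injective () | tri< _ _ _ | tri> _ _ _
  sgn-injective () | tri≈ _ _ _ | tri< _ _ _
  sgn-injective () | tri≈ _ _ _ | tri> _ _ _
  sgn-injective () | tri> _ _ _ | tri< _ _ _
  sgn-injective () | tri> _ _ _ | tri≈ _ _ _

  SameSign⇒sgn-≡ : ∀ {x y} → SameSign x y → sgn x ≡ sgn y
  SameSign⇒sgn-≡ xy = ℕₚ.≤-antisym (half xy) (half (SameSign-sym xy))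
    where
    half : ∀ {x y} → SameSign x y → sgn x ℕ.≤ sgn y
    half {x} {y} xy with compare x 0# | compare y 0#
    ... | tri< _ _ _ | _          = z≤n
    ... | tri≈ _ _ _ | tri≈ _ _ _ = ℕₚ.≤-refl
    ... | tri≈ _ _ _ | tri> _ _ _ = s≤s z≤n
    ... | tri> _ _ _ | tri> _ _ _ = ℕₚ.≤-refl
    half (negative a _) | tri≈ ¬x<0 _ _ | tri< _ _ _   = contradiction a ¬x<0
    half (null _ b)     | tri≈ _ _ _ | tri< _ ¬y≈0 _   = contradiction b ¬y≈0
    half (positive _ b) | tri≈ _ _ _ | tri< _ _ ¬0<y   = contradiction b ¬0<y
    half (negative a _) | tri> ¬x<0 _ _ | tri< _ _ _   = contradiction a ¬x<0
    half (null _ b)     | tri> _ _ _ | tri< _ ¬y≈0 _   = contradiction b ¬y≈0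
    half (positive _ b) | tri> _ _ _ | tri< _ _ ¬0<y   = contradiction b ¬0<y
    half (negative a _) | tri> ¬x<0 _ _ | tri≈ _ _ _   = contradiction a ¬x<0
    half (null a _)     | tri> _ ¬x≈0 _ | tri≈ _ _ _   = contradiction a ¬x≈0
    half (positive _ b) | tri> _ _ _ | tri≈ _ _ ¬0<y   = contradiction b ¬0<y

  -- Every summand is monotone in x, so equal ranks force equal signs at each breakpoint.
  rank : List ℝ → ℝ → ℕ
  rank []      x = 0
  rank (r ∷ L) x = sgn (x - r) ℕ.+ rank L x

  -- l distinct points leave l + 1 open intervals and l singletons. The list is neither sorted nor
  -- free of repetitions; a repeated breakpoint only makes some indices belong to no parameter.
  cells : List ℝ → ℕ
  cells L = suc (length L ℕ.* 2)

  rank<cells : ∀ L x → rank L x ℕ.< cells L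
  rank<cells []      x = s≤s z≤n
  rank<cells (r ∷ L) x = ≡.subst (ℕ._≤ cells (r ∷ L)) (ℕₚ.+-suc (sgn (x - r)) _) (ℕₚ.+-mono-≤ (sgn≤2 (x - r)) (rank<cells L x))

  rank-mono : ∀ L {x y} → x ≤ y → rank L x ℕ.≤ rank L y
  rank-mono []      x≤y = z≤n
  rank-mono (r ∷ L) x≤y = ℕₚ.+-mono-≤ (sgn-mono (+-monoˡ-≤ (- r) x≤y)) (rank-mono L x≤y)

  +-mono-≤-equality : ∀ {a b c d} → a ℕ.≤ c → b ℕ.≤ d → a ℕ.+ b ≡ c ℕ.+ d → a ≡ c × b ≡ d
  +-mono-≤-equality {a} {b} {c} {d} a≤c b≤d eq = a≡c , ℕₚ.+-cancelˡ-≡ c b d (≡.subst (λ a → a ℕ.+ b ≡ c ℕ.+ d) a≡c eq)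
    where
    c≤a : c ℕ.≤ a
    c≤a = ℕₚ.+-cancelʳ-≤ b c a (ℕₚ.≤-trans (ℕₚ.+-monoʳ-≤ c b≤d) (ℕₚ.≤-reflexive (≡.sym eq)))
    a≡c : a ≡ c
    a≡c = ℕₚ.≤-antisym a≤c c≤a

  rank-injective-≤ : ∀ L {x y} → x ≤ y → rank L x ≡ rank L y → Indistinguishable L x y
  rank-injective-≤ []      x≤y eq = []
  rank-injective-≤ (r ∷ L) x≤y eq with +-mono-≤-equality (sgn-mono (+-monoˡ-≤ (- r) x≤y)) (rank-mono L x≤y) eq
  ... | eq₁ , eq₂ = sgn-injective eq₁ ∷ rank-injective-≤ L x≤y eq₂

  rank-injective : ∀ L {x y} → rank L x ≡ rank L y → Indistinguishable L x y
  rank-injective L {x} {y} eq with total x y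
  ... | inj₁ x≤y = rank-injective-≤ L x≤y eq
  ... | inj₂ y≤x = All.map SameSign-sym (rank-injective-≤ L y≤x (≡.sym eq))

  cell : ∀ L → ℝ → Fin (cells L)
  cell L x = fromℕ< (rank<cells L x)

  cell-injective : ∀ L {x y} → cell L x ≡ cell L y → Indistinguishable L x y
  cell-injective L eq = rank-injective L (Finₚ.fromℕ<-injective _ _ _ _ eq)

  Indistinguishable⇒rank-≡ : ∀ {L x y} → Indistinguishable L x y → rank L x ≡ rank L y
  Indistinguishable⇒rank-≡ []       = ≡.refl
  Indistinguishable⇒rank-≡ (p ∷ ps) = ≡.cong₂ ℕ._+_ (SameSign⇒sgn-≡ p) (Indistinguishable⇒rank-≡ ps)

  -- Needed when a list of breakpoints is extended: it places each cell of the longer list inside a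
  -- single cell of L, whose choice of walks can then be reused.
  Indistinguishable⇒cell-≡ : ∀ L {x y} → Indistinguishable L x y → cell L x ≡ cell L y
  Indistinguishable⇒cell-≡ L xy = Finₚ.fromℕ<-cong _ _ (Indistinguishable⇒rank-≡ xy) _ _

-- Real powers and logarithms, estimated at natural exponents.

module Powers (lem : ExcludedMiddle 0ℓ) (ℛ : RealField) where
  open RealField ℛ hiding (zero)
  open IntegerSolver commutativeRing
  open OrderedField lem ℛ
  open Exponential lem ℛ
  open Exp semiring using (^-homo-*; ^-assocʳ)
  open Mult semiring using (×-homo-+; ×1-homo-*)
  open ≤-Reasoning ≤-poset

  ι-+ : ∀ m n → ι (m ℕ.+ n) ≈ ι m + ι n
  ι-+ = ×-homo-+ 1#

  ι-* : ∀ m n → ι (m ℕ.* n) ≈ ι m * ι n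
  ι-* = ×1-homo-*

  ι-^ : ∀ m n → ι (m ℕ.^ n) ≈ ι m ^ n
  ι-^ m zero    = +-identityʳ 1#
  ι-^ m (suc n) = trans (ι-* m (m ℕ.^ n)) (*-congˡ (ι-^ m n))

  0≤ι : ∀ n → 0# ≤ ι n
  0≤ι zero    = ≤-refl
  0≤ι (suc n) = ≤-respˡ-≈ (+-identityˡ 0#) (+-mono-≤ (proj₁ 0<1) (0≤ι n))

  ι-mono : ∀ {m n} → m ℕ.≤ n → ι m ≤ ι n
  ι-mono {n = n} z≤n = 0≤ι n
  ι-mono (s≤s m≤n)    = +-monoʳ-≤ 1# (ι-mono m≤n)

  ι-cancel-≤ : ∀ {m n} → ι m ≤ ι n → m ℕ.≤ n
  ι-cancel-≤ {m} {n} ιm≤ιn = ℕₚ.≮⇒≥ λ n<m → <⇒≱ (x<x+1 (ι n)) (begin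
    ι n + 1#   ≈⟨ +-comm (ι n) 1# ⟩
    ι (suc n)  ≤⟨ ι-mono n<m ⟩
    ι m        ≤⟨ ιm≤ιn ⟩
    ι n        ∎)

  -- If the naturals were bounded, they would have a supremum s; from n + 1 ≤ s for all n, s - 1
  -- would be a smaller upper bound.
  archimedean : ∀ x → ∃ λ n → x ≤ ι n
  archimedean x with lem {∃ λ n → x ≤ ι n}
  ... | yes bounded   = bounded
  ... | no  unbounded = contradiction (proj₂ (proj₂ supremum) (s - 1#) s-1-upper) (<⇒≱ s-1<s)
    where
    P : Pred ℝ 0ℓ
    P y = ∃ λ n → y ≈ ι n
    supremum : Satisfiable (IsSupremum P)
    supremum = complete P (ι 0 , 0 , refl) (x , below)
      where
      below : ∀ y → y ∈ P → y ≤ x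
      below y (n , y≈ιn) with total y x
      ... | inj₁ y≤x = y≤x
      ... | inj₂ x≤y = contradiction (n , ≤-respʳ-≈ y≈ιn x≤y) unbounded
    s : ℝ
    s = proj₁ supremum
    s-1<s : s - 1# < s
    s-1<s = 0<y-x⇒x<y (<-respʳ-≈ (solve 1 (λ s → :1 := s :- (s :- :1)) refl s) 0<1)
    s-1-upper : ∀ y → y ∈ P → y ≤ s - 1#
    s-1-upper y (n , y≈ιn) = 0≤y-x⇒x≤y (begin
      0#                ≤⟨ x≤y⇒0≤y-x (proj₁ (proj₂ supremum) (ι (suc n)) (suc n , refl)) ⟩
      s - (1# + ι n)    ≈⟨ solve 2 (λ s n → s :- (:1 :+ n) := (s :- :1) :- n) refl s (ι n) ⟩
      (s - 1#) - ι n    ≈⟨ +-congˡ (-‿cong y≈ιn) ⟨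
      (s - 1#) - y      ∎)

  *-cancelʳ-≤ : ∀ {c x y} → 0# < c → x * c ≤ y * c → x ≤ y
  *-cancelʳ-≤ {c} {x} {y} 0<c xc≤yc = ≮⇒≥ λ y<x → <⇒≱ (0<y-x⇒x<y (<-respʳ-≈
    (solve 3 (λ c x y → (x :- y) :* c := x :* c :- y :* c) refl c x y) (*-pos (x<y⇒0<y-x y<x) 0<c))) xc≤yc

  ^-nonNeg : ∀ {x} n → 0# ≤ x → 0# ≤ x ^ n
  ^-nonNeg zero    0≤x = proj₁ 0<1
  ^-nonNeg (suc n) 0≤x = *-nonNeg 0≤x (^-nonNeg n 0≤x)

  ^-pos : ∀ {x} n → 0# < x → 0# < x ^ n
  ^-pos zero    0<x = 0<1
  ^-pos (suc n) 0<x = *-pos 0<x (^-pos n 0<x)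

  ^-monoˡ-≤ : ∀ {x y} n → 0# ≤ x → x ≤ y → x ^ n ≤ y ^ n
  ^-monoˡ-≤ zero    0≤x x≤y = ≤-refl
  ^-monoˡ-≤ (suc n) 0≤x x≤y = *-mono-≤ 0≤x (^-nonNeg n 0≤x) x≤y (^-monoˡ-≤ n 0≤x x≤y)

  ^-cancelˡ-≤ : ∀ {x y} n → 0# ≤ y → x ^ suc n ≤ y ^ suc n → x ≤ y
  ^-cancelˡ-≤ {x} {y} n 0≤y xⁿ≤yⁿ = ≮⇒≥ λ y<x → <⇒≱ y<x
    (*-cancelʳ-≤ (^-pos n (≤-<-trans 0≤y y<x)) (begin
      x * x ^ n  ≤⟨ xⁿ≤yⁿ ⟩
      y * y ^ n  ≤⟨ *-monoʳ-≤ 0≤y (^-monoˡ-≤ n 0≤y (proj₁ y<x)) ⟩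
      y * x ^ n  ∎))

  1≤^ : ∀ {x} n → 1# ≤ x → 1# ≤ x ^ n
  1≤^ zero    1≤x = ≤-refl
  1≤^ (suc n) 1≤x = ≤-respˡ-≈ (*-identityˡ 1#) (*-mono-≤ (proj₁ 0<1) (proj₁ 0<1) 1≤x (1≤^ n 1≤x))

  ^-monoʳ-≤ : ∀ {x m n} → 1# ≤ x → m ℕ.≤ n → x ^ m ≤ x ^ n
  ^-monoʳ-≤ {n = n} 1≤x z≤n       = 1≤^ n 1≤x
  ^-monoʳ-≤         1≤x (s≤s m≤n) = *-monoʳ-≤ (≤-trans (proj₁ 0<1) 1≤x) (^-monoʳ-≤ 1≤x m≤n)

  ≤-sup : ∀ {P z} → z ∈ P → Satisfiable (UpperBound P) → z ≤ sup P
  ≤-sup {P} {z} z∈P bounded with lem {Satisfiable P × Satisfiable (UpperBound P)}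
  ... | yes (nonempty , bounded′) = proj₁ (proj₂ (complete P nonempty bounded′)) z z∈P
  ... | no unbounded = contradiction ((z , z∈P) , bounded) unbounded

  -- The hypothesis 0# ≤ u covers the junk value sup P = 0#.
  sup-≤ : ∀ {P u} → UpperBound P u → 0# ≤ u → sup P ≤ u
  sup-≤ {P} {u} P≤u 0≤u with lem {Satisfiable P × Satisfiable (UpperBound P)}
  ... | yes (nonempty , bounded) = proj₂ (proj₂ (complete P nonempty bounded)) u P≤u
  ... | no _ = 0≤u

  -- Copies the set whose supremum defines _^ℝ_.
  RationalPower : ℝ → ℝ → Pred ℝ 0ℓ
  RationalPower b y z = 0# ≤ z × ∃ λ k → ∃ λ l → ∃ λ d →
    NonZero d × ι k ≤ ι d * y + ι l × z ^ d * b ^ l ≤ b ^ k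

  -- The condition on k, l, d together with y ≤ m gives k ≤ m d + l in the naturals, hence z^d b^l ≤
  -- (b^m)^d b^l; cancel b^l, then the exponent d.
  RationalPower-≤ : ∀ {b y} m → 1# ≤ b → y ≤ ι m → UpperBound (RationalPower b y) (b ^ m)
  RationalPower-≤ {b} {y} m 1≤b y≤m z (0≤z , k , l , suc d , _ , k≤dy+l , zᵈbˡ≤bᵏ) =
    ^-cancelˡ-≤ d (^-nonNeg m (proj₁ 0<b)) (*-cancelʳ-≤ (^-pos l 0<b) (begin
      z ^ suc d * b ^ l          ≤⟨ zᵈbˡ≤bᵏ ⟩
      b ^ k                      ≤⟨ ^-monoʳ-≤ 1≤b k≤md+l ⟩
      b ^ (m ℕ.* suc d ℕ.+ l)    ≈⟨ ^-homo-* b (m ℕ.* suc d) l ⟩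
      b ^ (m ℕ.* suc d) * b ^ l  ≈⟨ *-congʳ (^-assocʳ b m (suc d)) ⟨
      (b ^ m) ^ suc d * b ^ l    ∎))
    where
    0<b : 0# < b
    0<b = <-≤-trans 0<1 1≤b
    k≤md+l : k ℕ.≤ m ℕ.* suc d ℕ.+ l
    k≤md+l = ι-cancel-≤ (begin
      ι k                      ≤⟨ k≤dy+l ⟩
      ι (suc d) * y + ι l      ≤⟨ +-monoˡ-≤ (ι l) (*-monoʳ-≤ (0≤ι (suc d)) y≤m) ⟩
      ι (suc d) * ι m + ι l    ≈⟨ +-congʳ (*-comm (ι (suc d)) (ι m)) ⟩
      ι m * ι (suc d) + ι l    ≈⟨ +-congʳ (ι-* m (suc d)) ⟨
      ι (m ℕ.* suc d) + ι l    ≈⟨ ι-+ (m ℕ.* suc d) l ⟨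
      ι (m ℕ.* suc d ℕ.+ l)    ∎)

  ^ℝ-upper : ∀ {b y} m → 1# ≤ b → y ≤ ι m → b ^ℝ y ≤ b ^ m
  ^ℝ-upper m 1≤b y≤m = sup-≤ (RationalPower-≤ m 1≤b y≤m) (^-nonNeg m (≤-trans (proj₁ 0<1) 1≤b))

  -- A member bounds `sup` from below only if the set is bounded above, since otherwise `sup` takes
  -- its default value; a natural number above y provides such a bound.
  ^ℝ-lower : ∀ {b y} m → 1# ≤ b → ι m ≤ y → b ^ m ≤ b ^ℝ y
  ^ℝ-lower {b} {y} m 1≤b m≤y = ≤-sup {RationalPower b y} bᵐ∈ bounded
    where
    bounded : Satisfiable (UpperBound (RationalPower b y))
    bounded = b ^ proj₁ (archimedean y) , RationalPower-≤ (proj₁ (archimedean y)) 1≤b (proj₂ (archimedean y))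
    bᵐ∈ : b ^ m ∈ RationalPower b y
    -- The rational exponent is (m - 0) / 1.
    bᵐ∈ = ^-nonNeg m (≤-trans (proj₁ 0<1) 1≤b) , m , 0 , 1 , _ ,
      ≤-respʳ-≈ (solve 1 (λ y → y := (:1 :+ :0) :* y :+ :0) refl y) m≤y ,
      ≤-reflexive (solve 1 (λ x → (x :* :1) :* :1 := x) refl (b ^ m))

  1≤ι : ∀ {n} → 1 ℕ.≤ n → 1# ≤ ι n
  1≤ι 1≤n = ≤-respˡ-≈ (+-identityʳ 1#) (ι-mono {1} 1≤n)

  -- k belongs to the set whose supremum is log₂ n. That set is bounded by n itself, because n <
  -- 2^n.
  log₂-lower : ∀ k n → 2 ℕ.^ k ℕ.≤ n → ι k ≤ log₂ (ι n)
  log₂-lower k n 2ᵏ≤n = ≤-sup {λ y → ι 2 ^ℝ y ≤ ι n} 2^k≤n (ι n , below)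
    where
    2^k≤n : ι 2 ^ℝ ι k ≤ ι n
    2^k≤n = begin
      ι 2 ^ℝ ι k    ≤⟨ ^ℝ-upper k (1≤ι {2} (s≤s z≤n)) ≤-refl ⟩
      ι 2 ^ k       ≈⟨ ι-^ 2 k ⟨
      ι (2 ℕ.^ k)   ≤⟨ ι-mono 2ᵏ≤n ⟩
      ι n           ∎
    n<2^n : ∀ n → n ℕ.< 2 ℕ.^ n
    n<2^n zero    = s≤s z≤n
    n<2^n (suc n) = ℕₚ.≤-trans (ℕₚ.+-mono-≤ (ℕₚ.m^n>0 2 n) (n<2^n n))
      (ℕₚ.≤-reflexive (≡.cong (2 ℕ.^ n ℕ.+_) (≡.sym (ℕₚ.+-identityʳ (2 ℕ.^ n)))))
    below : UpperBound (λ y → ι 2 ^ℝ y ≤ ι n) (ι n)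
    below y 2^y≤n = ≮⇒≥ λ n<y → ℕₚ.<⇒≱ (n<2^n n) (ι-cancel-≤ (begin
      ι (2 ℕ.^ n)   ≈⟨ ι-^ 2 n ⟩
      ι 2 ^ n       ≤⟨ ^ℝ-lower n (1≤ι {2} (s≤s z≤n)) (proj₁ n<y) ⟩
      ι 2 ^ℝ y      ≤⟨ 2^y≤n ⟩
      ι n           ∎))

  ^-log₂-bound : ∀ c j k {n q} → 1 ℕ.≤ n → 2 ℕ.^ k ℕ.≤ n → 2 ℕ.^ j ℕ.≤ q →
                 ι (n ℕ.^ (c ℕ.* (k ℕ.+ j))) ≤ ι n ^ℝ (ι c * (log₂ (ι n) + log₂ (ι q)))
  ^-log₂-bound c j k {n} {q} 1≤n 2ᵏ≤n 2ʲ≤q = begin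
    ι (n ℕ.^ (c ℕ.* (k ℕ.+ j)))                 ≈⟨ ι-^ n (c ℕ.* (k ℕ.+ j)) ⟩
    ι n ^ (c ℕ.* (k ℕ.+ j))                     ≤⟨ ^ℝ-lower (c ℕ.* (k ℕ.+ j)) (1≤ι 1≤n) exponent ⟩
    ι n ^ℝ (ι c * (log₂ (ι n) + log₂ (ι q)))    ∎
    where
    exponent : ι (c ℕ.* (k ℕ.+ j)) ≤ ι c * (log₂ (ι n) + log₂ (ι q))
    exponent = begin
      ι (c ℕ.* (k ℕ.+ j))              ≈⟨ trans (ι-* c (k ℕ.+ j)) (*-congˡ (ι-+ k j)) ⟩
      ι c * (ι k + ι j)                ≤⟨ *-monoʳ-≤ (0≤ι c) (+-mono-≤ (log₂-lower k n 2ᵏ≤n) (log₂-lower j q 2ʲ≤q)) ⟩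
      ι c * (log₂ (ι n) + log₂ (ι q))  ∎

-- Finite counting and estimates over the naturals.

lookup-injective : ∀ {A : Set} {xs : List A} → Unique xs →
                   ∀ {i j} → List.lookup xs i ≡ List.lookup xs j → i ≡ j
lookup-injective (x∉xs ∷ _)  {zero}  {zero}  eq = ≡.refl
lookup-injective (x∉xs ∷ _)  {zero}  {suc j} eq = contradiction eq (All.lookup x∉xs (∈-lookup j))
lookup-injective (x∉xs ∷ _)  {suc i} {zero}  eq = contradiction (≡.sym eq) (All.lookup x∉xs (∈-lookup i))
lookup-injective (_ ∷ xs!)   {suc i} {suc j} eq = ≡.cong suc (lookup-injective xs! eq)

Unique⇒length≤ : ∀ {n} {xs : List (Fin n)} → Unique xs → length xs ℕ.≤ n
Unique⇒length≤ xs! = Finₚ.injective⇒≤ (lookup-injective xs!)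

-- l old breakpoints, and at most c new ones for each of the 2 l + 1 old cells. The estimate is
-- multiplicative without loss: 1 + 2 (l + (2 l + 1) c) = (2 l + 1) (2 c + 1), so it can be
-- iterated.
refinement-bound : ∀ l {m} c → m ℕ.≤ suc (l ℕ.* 2) ℕ.* c →
                   suc ((l ℕ.+ m) ℕ.* 2) ℕ.≤ suc (l ℕ.* 2) ℕ.* suc (c ℕ.* 2)
refinement-bound l {m} c m≤ = begin
  suc ((l ℕ.+ m) ℕ.* 2)                        ≤⟨ s≤s (ℕₚ.*-monoˡ-≤ 2 (ℕₚ.+-monoʳ-≤ l m≤)) ⟩
  suc ((l ℕ.+ suc (l ℕ.* 2) ℕ.* c) ℕ.* 2)
    ≡⟨ solve 2 (λ l c → con 1 :+ (l :+ (con 1 :+ l :* con 2) :* c) :* con 2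
                     := (con 1 :+ l :* con 2) :* (con 1 :+ c :* con 2)) ≡.refl l c ⟩
  suc (l ℕ.* 2) ℕ.* suc (c ℕ.* 2)              ∎
  where
  open ℕₚ.≤-Reasoning
  open +-*-Solver

floor-log₂ : ∀ n → 1 ℕ.≤ n → ∃ λ k → 2 ℕ.^ k ℕ.≤ n × n ℕ.< 2 ℕ.^ suc k
floor-log₂ 1             _ = 0 , ℕₚ.≤-refl , ℕₚ.≤-refl
floor-log₂ (suc (suc n)) _ with floor-log₂ (suc n) (s≤s z≤n)
... | k , 2ᵏ≤ , <2ᵏ⁺¹ with suc (suc n) ℕₚ.<? 2 ℕ.^ suc k
...   | yes <    = k , ℕₚ.m≤n⇒m≤1+n 2ᵏ≤ , <
...   | no  ≮    = suc k , ℕₚ.≮⇒≥ ≮ , ℕₚ.≤-<-trans <2ᵏ⁺¹ (ℕₚ.m<m+n _ (ℕₚ.m≤n⇒m≤n+o 0 (ℕₚ.m^n>0 2 (suc k))))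

^-distribʳ-* : ∀ m n k → (m ℕ.* n) ℕ.^ k ≡ m ℕ.^ k ℕ.* n ℕ.^ k
^-distribʳ-* m n zero    = ≡.refl
^-distribʳ-* m n (suc k) = ≡.trans (≡.cong (m ℕ.* n ℕ.*_) (^-distribʳ-* m n k))
  (ℕₚ.[m*n]*[o*p]≡[m*o]*[n*p] m n (m ℕ.^ k) (n ℕ.^ k))

growth-bound : ∀ n q → 2 ℕ.≤ n → 1 ℕ.≤ q → suc ((n ℕ.* (n ℕ.* (n ℕ.* (n ℕ.* q)))) ℕ.* 2) ℕ.≤ n ℕ.^ 6 ℕ.* q
growth-bound n@(suc n′) q@(suc q′) 2≤n 1≤q = begin
  -- 1 ≤ c holds by computation: with n and q matched as successors, c reduces to a successor.
  suc (c ℕ.* 2)           ≤⟨ ℕₚ.+-monoˡ-≤ (c ℕ.* 2) (s≤s {0} z≤n) ⟩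
  c ℕ.+ c ℕ.* 2           ≤⟨ ℕₚ.m≤n+m _ c ⟩
  c ℕ.+ (c ℕ.+ c ℕ.* 2)   ≡⟨ solve 1 (λ c → c :+ (c :+ c :* con 2) := con 2 :* con 2 :* c) ≡.refl c ⟩
  2 ℕ.* 2 ℕ.* c           ≤⟨ ℕₚ.*-monoˡ-≤ c (ℕₚ.*-mono-≤ 2≤n 2≤n) ⟩
  n ℕ.* n ℕ.* c
    ≡⟨ solve 2 (λ n q → n :* n :* (n :* (n :* (n :* (n :* q))))
        := (n :* (n :* (n :* (n :* (n :* (n :* con 1)))))) :* q) ≡.refl n q ⟩
  n ℕ.^ 6 ℕ.* q           ∎
  where
  open ℕₚ.≤-Reasoning
  open +-*-Solver
  c : ℕ
  c = n ℕ.* (n ℕ.* (n ℕ.* (n ℕ.* q)))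

-- k and j serve as the floors of log n and log q. The factor q^(k+1) is at most (2^(j+1))^(k+1) =
-- (2^(k+1))^(j+1), and 2^(k+1) ≤ n² turns this into n^(2 (j+1)).
power-growth-bound : ∀ {n q g} j k → 2 ℕ.≤ n → g ℕ.≤ n ℕ.^ 6 ℕ.* q →
                     2 ℕ.^ k ℕ.≤ n → n ℕ.< 2 ℕ.^ suc k → q ℕ.< 2 ℕ.^ suc j →
                     g ℕ.^ suc k ℕ.≤ n ℕ.^ (14 ℕ.* (k ℕ.+ j))
power-growth-bound j zero 2≤n _ _ n<2 _ = contradiction n<2 (ℕₚ.≤⇒≯ 2≤n)
power-growth-bound {n@(suc _)} {q} {g} j k@(suc k′) 2≤n g≤ 2ᵏ≤n n<2ᵏ⁺¹ q<2ʲ⁺¹ = begin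
  g ^ suc k                                       ≤⟨ ℕₚ.^-monoˡ-≤ (suc k) (ℕₚ.≤-trans g≤ (ℕₚ.*-monoʳ-≤ (n ^ 6) (ℕₚ.<⇒≤ q<2ʲ⁺¹))) ⟩
  (n ^ 6 * 2 ^ suc j) ^ suc k                     ≡⟨ ^-distribʳ-* (n ^ 6) (2 ^ suc j) (suc k) ⟩
  (n ^ 6) ^ suc k * (2 ^ suc j) ^ suc k           ≡⟨ ≡.cong₂ _*_ (ℕₚ.^-*-assoc n 6 (suc k)) exchange ⟩
  n ^ (6 * suc k) * (2 ^ suc k) ^ suc j           ≤⟨ ℕₚ.*-monoʳ-≤ (n ^ (6 * suc k)) (ℕₚ.^-monoˡ-≤ (suc j) 2ᵏ⁺¹≤n²) ⟩
  n ^ (6 * suc k) * (n ^ 2) ^ suc j               ≡⟨ ≡.cong (n ^ (6 * suc k) *_) (ℕₚ.^-*-assoc n 2 (suc j)) ⟩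
  n ^ (6 * suc k) * n ^ (2 * suc j)               ≡⟨ ℕₚ.^-distribˡ-+-* n (6 * suc k) (2 * suc j) ⟨
  n ^ (6 * suc k + 2 * suc j)                     ≤⟨ ℕₚ.^-monoʳ-≤ n exponent ⟩
  n ^ (14 * (k + j))                              ∎
  where
  open ℕₚ.≤-Reasoning
  open import Data.Nat using (_^_; _*_; _+_)
  exchange : (2 ^ suc j) ^ suc k ≡ (2 ^ suc k) ^ suc j
  exchange = ≡.trans (ℕₚ.^-*-assoc 2 (suc j) (suc k))
    (≡.trans (≡.cong (2 ^_) (ℕₚ.*-comm (suc j) (suc k))) (≡.sym (ℕₚ.^-*-assoc 2 (suc k) (suc j))))
  2ᵏ⁺¹≤n² : 2 ^ suc k ℕ.≤ n ^ 2
  2ᵏ⁺¹≤n² = ℕₚ.*-mono-≤ 2≤n (ℕₚ.≤-trans 2ᵏ≤n (ℕₚ.≤-reflexive (≡.sym (ℕₚ.*-identityʳ n))))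
  -- The constant 14 is the value of the left side at k = 1, j = 0. Here n ≥ 2 has excluded k = 0,
  -- where no multiple of k + j could work for j = 0.
  exponent : 6 * suc k + 2 * suc j ℕ.≤ 14 * (k + j)
  exponent = ℕₚ.≤-trans (ℕₚ.m≤m+n _ (8 * k′ + 12 * j)) (ℕₚ.≤-reflexive
    (solve 2 (λ k j → (con 6 :* (con 2 :+ k) :+ con 2 :* (con 1 :+ j)) :+ (con 8 :* k :+ con 12 :* j)
                   := con 14 :* ((con 1 :+ k) :+ j)) ≡.refl k′ j))
    where open +-*-Solver

-- Walks, their weights, and the removal of cycles.

module Walks (lem : ExcludedMiddle 0ℓ) (ℛ : RealField) {n q : ℕ} (G : ParametricGraph.WeightedDigraph ℛ n q) where
  open RealField ℛ hiding (zero)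
  open ParametricGraph ℛ
  open WeightedDigraph G
  open IntegerSolver commutativeRing
  open OrderedField lem ℛ
  open PolynomialFunctions lem ℛ
  open Breakpoints lem ℛ
  open ≤-Reasoning ≤-poset

  deduplicate : ∀ {A : Set} (xs : List A) → ∃ λ ys → Unique ys × length ys ℕ.≤ length xs × xs ⊆ ys × ys ⊆ xs
  deduplicate [] = [] , [] , z≤n , (λ ()) , (λ ())
  deduplicate (x ∷ xs) with deduplicate xs | lem {x ∈ᴸ xs}
  ... | ys , ys! , ys≤xs , xs⊆ys , ys⊆xs | yes x∈xs =
    ys , ys! , ℕₚ.m≤n⇒m≤1+n ys≤xs , (λ { (here ≡.refl) → xs⊆ys x∈xs ; (there ∈xs) → xs⊆ys ∈xs }) , λ ∈ys → there (ys⊆xs ∈ys)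
  ... | ys , ys! , ys≤xs , xs⊆ys , ys⊆xs | no x∉xs =
    x ∷ ys , All.tabulate (λ { y∈ys ≡.refl → x∉xs (ys⊆xs y∈ys) }) ∷ ys! , s≤s ys≤xs ,
    (λ { (here eq) → here eq ; (there ∈xs) → there (xs⊆ys ∈xs) }) ,
    (λ { (here eq) → here eq ; (there ∈ys) → there (ys⊆xs ∈ys) })

  len : ∀ {u v} → Walk G u v → ℕ
  len ε       = 0
  len (_ ◅ p) = suc (len p)

  length-vertices : ∀ {u v} (p : Walk G u v) → length (vertices G p) ≡ suc (len p)
  length-vertices ε       = ≡.refl
  length-vertices (_ ◅ p) = ≡.cong suc (length-vertices p)

  IsPath⇒len≤ : ∀ {u v} {p : Walk G u v} → IsPath G p → len p ℕ.≤ n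
  IsPath⇒len≤ {p = p} p! = ℕₚ.≤-trans (ℕₚ.n≤1+n _) (≡.subst (ℕ._≤ n) (length-vertices p) (Unique⇒length≤ p!))

  weight-◅◅ : ∀ x {u v w} (p : Walk G u v) (p′ : Walk G v w) → weight G x (p ◅◅ p′) ≈ weight G x p + weight G x p′
  weight-◅◅ x ε       p′ = sym (+-identityˡ _)
  weight-◅◅ x (e ◅ p) p′ = trans (+-congˡ (weight-◅◅ x p p′)) (sym (+-assoc _ _ _))

  ⟦⟧-Deg : ∀ d (a : Poly d) → Deg d ⟦ a ⟧
  ⟦⟧-Deg zero    a = a zero , λ x → solve 1 (λ a → a :* :1 :+ :0 := a) refl (a zero)
  ⟦⟧-Deg (suc d) a = a zero , ⟦ (λ i → a (suc i)) ⟧ , ⟦⟧-Deg d (λ i → a (suc i)) , λ x →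
    +-cong (*-identityʳ _) (trans
      (sum-cong-≋ {suc d} (λ i → solve 3 (λ x a y → a :* (x :* y) := x :* (a :* y)) refl x (a (suc i)) (x ^ toℕ i)))
      (sym (*-distribˡ-sum x (λ i → a (suc i) * x ^ toℕ i))))
    where
    open Sum semiring using (sum-cong-≋; *-distribˡ-sum)

  weight-Deg : ∀ {u v} (p : Walk G u v) → Deg q (λ x → weight G x p)
  weight-Deg ε       = Deg-const q 0#
  weight-Deg (e ◅ p) = Deg-+ q (⟦⟧-Deg q (wt e)) (weight-Deg p)

  -- The lengths are only bounded, so a walk that ends within m steps is completed by an empty
  -- second half.
  split-len : ∀ m {k u v} (p : Walk G u v) → len p ℕ.≤ m ℕ.+ k →
              ∃ λ w → ∃ λ (p₁ : Walk G u w) → ∃ λ (p₂ : Walk G w v) →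
              p ≡ p₁ ◅◅ p₂ × len p₁ ℕ.≤ m × len p₂ ℕ.≤ k
  split-len zero    p       p≤k   = _ , ε , p , ≡.refl , z≤n , p≤k
  split-len (suc m) ε       _     = _ , ε , ε , ≡.refl , z≤n , z≤n
  split-len (suc m) (e ◅ p) (s≤s p≤) with split-len m p p≤
  ... | w , p₁ , p₂ , eq , ≤m , ≤k = w , e ◅ p₁ , p₂ , ≡.cong (e ◅_) eq , s≤s ≤m , ≤k

  All-vertices-prefix : ∀ {P : Pred (Fin n) 0ℓ} {u v w} (p : Walk G u v) {p′ : Walk G v w} →
                        All P (vertices G (p ◅◅ p′)) → All P (vertices G p)
  All-vertices-prefix ε {ε}     (Pv ∷ _) = Pv ∷ []
  All-vertices-prefix ε {_ ◅ _} (Pv ∷ _) = Pv ∷ []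
  All-vertices-prefix (e ◅ p)   (Pv ∷ Pp) = Pv ∷ All-vertices-prefix p Pp

  split-∈ : ∀ {u v w} (p : Walk G v w) → IsPath G p → u ∈ᴸ vertices G p →
            ∃ λ (p₁ : Walk G v u) → ∃ λ (p₂ : Walk G u w) → p ≡ p₁ ◅◅ p₂ × IsPath G p₁ × IsPath G p₂
  split-∈ ε       p!         (here ≡.refl) = ε , ε , ≡.refl , p! , p!
  split-∈ (e ◅ p) p!         (here ≡.refl) = ε , e ◅ p , ≡.refl , [] ∷ [] , p!
  split-∈ (e ◅ p) (v∉p ∷ p!) (there u∈p) with split-∈ p p! u∈p
  ... | p₁ , p₂ , ≡.refl , p₁! , p₂! = e ◅ p₁ , p₂ , ≡.refl , All-vertices-prefix p₁ v∉p ∷ p₁! , p₂!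

  -- The path is chosen before x, so that one path serves a whole cell. If u reappears in the
  -- cleaned tail, the edge e followed by `p₁` is a cycle in the sense of `NoNegativeCycle`, as `p₁`
  -- is a path, and dropping it adds no weight.
  remove-cycles : ∀ {u v} (p : Walk G u v) → ∃ λ (p′ : Walk G u v) →
                  IsPath G p′ × ∀ x → NoNegativeCycle G x → weight G x p′ ≤ weight G x p
  remove-cycles ε = ε , [] ∷ [] , λ _ _ → ≤-refl
  remove-cycles {u} (e ◅ p) with remove-cycles p
  ... | p′ , p′! , p′≤p with lem {u ∈ᴸ vertices G p′}
  ...   | no u∉p′ = e ◅ p′ , All.tabulate (λ { v∈p′ ≡.refl → u∉p′ v∈p′ }) ∷ p′! , λ x nnc → +-monoʳ-≤ _ (p′≤p x nnc)
  ...   | yes u∈p′ with split-∈ p′ p′! u∈p′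
  ...     | p₁ , p₂ , ≡.refl , p₁! , p₂! = p₂ , p₂! , λ x nnc → begin
    weight G x p₂                                          ≈⟨ +-identityˡ _ ⟨
    0# + weight G x p₂                                     ≤⟨ +-monoˡ-≤ _ (≮⇒≥ (nnc e p₁ p₁!)) ⟩
    (⟦ wt e ⟧ x + weight G x p₁) + weight G x p₂           ≈⟨ +-assoc _ _ _ ⟩
    ⟦ wt e ⟧ x + (weight G x p₁ + weight G x p₂)           ≈⟨ +-congˡ (weight-◅◅ x p₁ p₂) ⟨
    ⟦ wt e ⟧ x + weight G x (p₁ ◅◅ p₂)                     ≤⟨ +-monoʳ-≤ _ (p′≤p x nnc) ⟩
    ⟦ wt e ⟧ x + weight G x p                              ∎

  -- Candidates are partial because a midpoint may offer no walk. The second conjunct records which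
  -- index attains the minimum; this index is what lets a comparison of candidates be transported to
  -- another parameter.
  argmin : ∀ {A : Set} (val : A → ℝ) {m} (f : Fin m → Maybe A) → ∃ λ c →
           (∀ i {a} → f i ≡ just a → ∃ λ b → c ≡ just b × val b ≤ val a) ×
           (∀ {b} → c ≡ just b → ∃ λ i → f i ≡ just b)
  argmin val {zero}  f = nothing , (λ ()) , λ ()
  argmin val {suc m} f with argmin val (λ i → f (suc i)) | f zero in f0
  ... | c , least , attained | nothing = c ,
    (λ { zero eq → contradiction (≡.trans (≡.sym f0) eq) λ () ; (suc i) eq → least i eq }) ,
    λ eq → suc (proj₁ (attained eq)) , proj₂ (attained eq)
  ... | nothing , least , attained | just a = just a ,
    (λ { zero eq → a , ≡.refl , here-least eq ; (suc i) eq → contradiction (proj₁ (proj₂ (least i eq))) λ () }) ,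
    λ { ≡.refl → zero , f0 }
    where
    here-least : ∀ {b} → f zero ≡ just b → val a ≤ val b
    here-least eq with ≡.refl ← ≡.trans (≡.sym f0) eq = ≤-refl
  ... | just b , least , attained | just a with total (val a) (val b)
  ...   | inj₁ a≤b = just a , (λ { zero eq → a , ≡.refl , here-least eq ; (suc i) eq → a , ≡.refl , ≤-trans a≤b (there-least i eq) }) ,
    λ { ≡.refl → zero , f0 }
    where
    here-least : ∀ {b} → f zero ≡ just b → val a ≤ val b
    here-least eq with ≡.refl ← ≡.trans (≡.sym f0) eq = ≤-refl
    there-least : ∀ i {c} → f (suc i) ≡ just c → val b ≤ val c
    there-least i eq with least i eq
    ... | _ , ≡.refl , b≤c = b≤c
  ...   | inj₂ b≤a = just b , (λ { zero eq → b , ≡.refl , here-least eq ; (suc i) eq → least i eq }) ,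
    λ eq → suc (proj₁ (attained eq)) , proj₂ (attained eq)
    where
    here-least : ∀ {c} → f zero ≡ just c → val b ≤ val c
    here-least eq with ≡.refl ← ≡.trans (≡.sym f0) eq = b≤a

  -- Lightest walks of at most m edges, cell by cell, by doubling m.

  Choice : Set
  Choice = ∀ u v → Maybe (Walk G u v)

  -- `nothing` is optimal exactly when no walk from u to v has at most m edges.
  Optimal : ℕ → ℝ → ∀ {u v} → Maybe (Walk G u v) → Set
  Optimal m x {u} {v} c = ∀ (p : Walk G u v) → len p ℕ.≤ m → ∃ λ p* → c ≡ just p* × weight G x p* ≤ weight G x p

  -- Without loops and parallel edges, at most one walk of at most one edge joins u to v. The choice
  -- is therefore independent of x, and the doubling starts from a single cell.
  edge-choice : ∀ u v → ∃ λ (c : Maybe (Walk G u v)) → ∀ x → Optimal 1 x c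
  edge-choice u v with u Finₚ.≟ v
  ... | yes ≡.refl = just ε , λ
    { x ε       _ → ε , ≡.refl , ≤-refl
    ; x (e ◅ ε) _ → contradiction e (loopless u)
    ; x (_ ◅ _ ◅ _) (s≤s ())
    }
  ... | no u≢v with T? (adjacent u v)
  ...   | yes e = just (e ◅ ε) , λ
    { x ε        _ → contradiction ≡.refl u≢v
    ; x (e′ ◅ ε) _ → e ◅ ε , ≡.refl , ≤-reflexive (reflexive (≡.cong (λ e → weight G x (e ◅ ε)) (T-irrelevant e e′)))
    ; x (_ ◅ _ ◅ _) (s≤s ())
    }
  ...   | no ¬e = nothing , λ
    { x ε       _ → contradiction ≡.refl u≢v
    ; x (e ◅ ε) _ → contradiction e ¬e
    ; x (_ ◅ _ ◅ _) (s≤s ())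
    }

  through : Choice → ∀ u v → Fin n → Maybe (Walk G u v)
  through W u v w = zipWith _◅◅_ (W u w) (W w v)

  -- On each of at most N cells of the parameter line, one walk per pair of
  -- vertices is lightest among all walks of at most m edges.
  Level : ℕ → ℕ → Set
  Level m N = ∃ λ L → ∃ λ (W : Fin (cells L) → Choice) →
    cells L ℕ.≤ N × ∀ x u v → Optimal m x (W (cell L x) u v)

  Comparable : Choice → ∀ u v (w w′ : Fin n) → Rel ℝ 0ℓ
  Comparable W u v w w′ x y = ∀ {p p′} → through W u v w ≡ just p → through W u v w′ ≡ just p′ →
    SameSign (weight G x p - weight G x p′) (weight G y p - weight G y p′)

  Comparable-determined : ∀ W u v w w′ → Determined q (Comparable W u v w w′)
  Comparable-determined W u v w w′ with through W u v w | through W u v w′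
  ... | nothing | _       = Determined-trivial q λ { () }
  ... | just p  | nothing = Determined-trivial q λ { _ () }
  ... | just p  | just p′ with Deg-SameSign-determined q (Deg-+ q (weight-Deg p) (Deg-neg q (weight-Deg p′)))
  ...   | L , L≤q , same = L , L≤q , λ { xy ≡.refl ≡.refl → same xy }

  -- One factor n for each of u, v, w, w′ and q roots per difference, nested as the applications of
  -- `Determined-∀` produce them.
  comparisons : ℕ
  comparisons = n ℕ.* (n ℕ.* (n ℕ.* (n ℕ.* q)))

  growth : ℕ
  growth = suc (comparisons ℕ.* 2)

  all-comparable-determined : ∀ {m} (W : Fin m → Choice) →
    Determined (m ℕ.* comparisons) (λ x y → ∀ i u v w w′ → Comparable (W i) u v w w′ x y)
  all-comparable-determined {m} W =
    Determined-∀ m λ i → Determined-∀ n λ u → Determined-∀ n λ v → Determined-∀ n λ w → Determined-∀ n λ w′ →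
    Comparable-determined (W i) u v w w′

  -- The winner is picked at x but has to win at y. At x it is no heavier than the candidate through
  -- the midpoint w of p, and comparability gives the difference of the two the same sign at y.
  best-through-optimal : ∀ {m x y u v} W → (∀ u v → Optimal m y (W u v)) →
    (∀ w w′ → Comparable W u v w w′ x y) →
    Optimal (m ℕ.+ m) y (proj₁ (argmin (weight G x) (through W u v)))
  best-through-optimal {m} {x} {y} {u} {v} W W-optimal comparable p p≤
    with split-len m p p≤
  ... | w , p₁ , p₂ , ≡.refl , p₁≤m , p₂≤m with W-optimal u w p₁ p₁≤m | W-optimal w v p₂ p₂≤m
  ...   | p₁* , eq₁ , p₁*≤p₁ | p₂* , eq₂ , p₂*≤p₂ with argmin (weight G x) (through W u v)
  ...     | c , least , attained with least w (≡.cong₂ (zipWith _◅◅_) eq₁ eq₂)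
  ...       | p* , eq , p*≤ with attained eq
  ...         | w* , eq* = p* , eq , (begin
    weight G y p*                          ≤⟨ 0≤y-x⇒x≤y (SameSign-nonNeg
                                               (comparable w w* (≡.cong₂ (zipWith _◅◅_) eq₁ eq₂) eq*) (x≤y⇒0≤y-x p*≤)) ⟩
    weight G y (p₁* ◅◅ p₂*)                ≈⟨ weight-◅◅ y p₁* p₂* ⟩
    weight G y p₁* + weight G y p₂*        ≤⟨ +-mono-≤ p₁*≤p₁ p₂*≤p₂ ⟩
    weight G y p₁ + weight G y p₂          ≈⟨ weight-◅◅ y p₁ p₂ ⟨
    weight G y (p₁ ◅◅ p₂)                  ∎)

  double : ∀ {m N} → Level m N → Level (m ℕ.+ m) (N ℕ.* growth)
  double {m} {N} (L , W , L≤N , W-optimal) =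
    L′ , (λ j → proj₁ (choice j)) , L′≤ , λ x → proj₂ (choice (cell L′ x)) x ≡.refl
    where
    breakpoints = all-comparable-determined W
    M = proj₁ breakpoints
    L′ = L ++ M
    choice : ∀ j → ∃ λ (C : Choice) → ∀ y → cell L′ y ≡ j → ∀ u v → Optimal (m ℕ.+ m) y (C u v)
    -- Excluded middle supplies a representative parameter of the cell, at which the candidates are
    -- compared; a cell without parameters receives a dummy choice.
    choice j with lem {∃ λ x → cell L′ x ≡ j}
    ... | no empty = (λ _ _ → nothing) , λ y y∈j → contradiction (y , y∈j) empty
    ... | yes (x , x∈j) = (λ u v → proj₁ (argmin (weight G x) (through (W i) u v))) ,
      λ y y∈j u v → best-through-optimal (W i)
        (≡.subst (λ i → ∀ u v → Optimal m y (W i u v)) (≡.sym (same-L-cell y∈j)) (W-optimal y))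
        (proj₂ (proj₂ breakpoints) (Allₚ.++⁻ʳ L (same-cell y∈j)) i u v)
      where
      i = cell L x
      same-cell : ∀ {y} → cell L′ y ≡ j → Indistinguishable L′ x y
      same-cell y∈j = cell-injective L′ (≡.trans x∈j (≡.sym y∈j))
      same-L-cell : ∀ {y} → cell L′ y ≡ j → i ≡ cell L y
      same-L-cell y∈j = Indistinguishable⇒cell-≡ L (Allₚ.++⁻ˡ L (same-cell y∈j))
    L′≤ : cells L′ ℕ.≤ N ℕ.* growth
    L′≤ = ℕₚ.≤-trans (ℕₚ.≤-reflexive (≡.cong (λ l → suc (l ℕ.* 2)) (Listₚ.length-++ L)))
      (ℕₚ.≤-trans (refinement-bound (length L) comparisons (proj₁ (proj₂ breakpoints))) (ℕₚ.*-monoˡ-≤ growth L≤N))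

  level : ∀ k → Level (2 ℕ.^ k) (growth ℕ.^ k)
  level zero    = [] , (λ _ u v → proj₁ (edge-choice u v)) , s≤s z≤n , λ x u v → proj₂ (edge-choice u v) x
  level (suc k) = ≡.subst₂ Level (≡.cong (2 ℕ.^ k ℕ.+_) (≡.sym (ℕₚ.+-identityʳ _))) (ℕₚ.*-comm (growth ℕ.^ k) growth)
    (double (level k))

  -- From lightest walks to covers by shortest paths.

  small-cover : ∀ {s t} → Satisfiable (IsPath G {s} {t}) → ∀ {S : Pred ℝ 0ℓ} → (∀ x → x ∈ S → NoNegativeCycle G x) →
                ∀ k → n ℕ.≤ 2 ℕ.^ k → ∃ λ 𝒮 → IsCover G s t S 𝒮 × length 𝒮 ℕ.≤ growth ℕ.^ k
  small-cover {s} {t} (p₀ , p₀!) {S} no-cycle k n≤2ᵏ = cover (level k)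
    where
    path : Maybe (Walk G s t) → ∃ (IsPath G {s} {t})
    -- Only cells without parameters get here, since elsewhere optimality against `p₀` itself
    -- excludes `nothing`. Their slot still has to hold a path.
    path nothing  = p₀ , p₀!
    path (just p) = proj₁ (remove-cycles p) , proj₁ (proj₂ (remove-cycles p))

    path-shortest : ∀ {x} c → Optimal (2 ℕ.^ k) x c → NoNegativeCycle G x → IsShortestPath G s t x (proj₁ (path c))
    path-shortest {x} c optimal nnc = proj₂ (path c) , shortest c optimal
      where
      shortest : ∀ c → Optimal (2 ℕ.^ k) x c → ∀ p → IsPath G p → weight G x (proj₁ (path c)) ≤ weight G x p
      shortest c optimal p p! with optimal p (ℕₚ.≤-trans (IsPath⇒len≤ p!) n≤2ᵏ)
      ... | p* , ≡.refl , p*≤p = ≤-trans (proj₂ (proj₂ (remove-cycles p*)) x nnc) p*≤p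

    paths : ∀ {m} → (Fin m → Choice) → Fin m → Walk G s t
    paths W i = proj₁ (path (W i s t))

    cover : Level (2 ℕ.^ k) (growth ℕ.^ k) → ∃ λ 𝒮 → IsCover G s t S 𝒮 × length 𝒮 ℕ.≤ growth ℕ.^ k
    cover (L , W , L≤ , W-optimal) with deduplicate (List.tabulate (paths W))
    ... | 𝒮 , 𝒮! , 𝒮≤ , ⊆𝒮 , 𝒮⊆ = 𝒮 , record
      { paths    = All-resp-⊇ 𝒮⊆ (Allₚ.tabulate⁺ {f = paths W} λ i → proj₂ (path (W i s t)))
      ; distinct = 𝒮!
      ; covers   = λ x x∈S → Any-resp-⊆ ⊆𝒮
          (Anyₚ.tabulate⁺ {f = paths W} (cell L x) (path-shortest (W (cell L x) s t) (W-optimal x s t) (no-cycle x x∈S)))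
      } , ℕₚ.≤-trans 𝒮≤ (ℕₚ.≤-trans (ℕₚ.≤-reflexive (Listₚ.length-tabulate (paths W))) L≤)

  -- Descent on the bound m: as long as a strictly shorter cover exists, pass to it.
  minimum-cover : ∀ {s t} {S : Pred ℝ 0ℓ} m 𝒮 → IsCover G s t S 𝒮 → length 𝒮 ℕ.≤ m →
                  ∃ λ 𝒯 → IsMSPC G s t S 𝒯 × length 𝒯 ℕ.≤ m
  minimum-cover {s} {t} {S} m 𝒮 𝒮-cover 𝒮≤m with lem {∃ λ 𝒯 → IsCover G s t S 𝒯 × length 𝒯 ℕ.< length 𝒮}
  minimum-cover m 𝒮 𝒮-cover 𝒮≤m | no minimal =
    𝒮 , (𝒮-cover , λ 𝒯 𝒯-cover → ℕₚ.≮⇒≥ λ 𝒯<𝒮 → minimal (𝒯 , 𝒯-cover , 𝒯<𝒮)) , 𝒮≤m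
  minimum-cover zero    𝒮 𝒮-cover 𝒮≤m | yes (𝒯 , 𝒯-cover , 𝒯<𝒮) = contradiction (ℕₚ.<-≤-trans 𝒯<𝒮 𝒮≤m) λ ()
  minimum-cover (suc m) 𝒮 𝒮-cover 𝒮≤m | yes (𝒯 , 𝒯-cover , 𝒯<𝒮)
    with minimum-cover m 𝒯 𝒯-cover (ℕₚ.≤-pred (ℕₚ.<-≤-trans 𝒯<𝒮 𝒮≤m))
  ... | 𝒰 , 𝒰-mspc , 𝒰≤m = 𝒰 , 𝒰-mspc , ℕₚ.m≤n⇒m≤1+n 𝒰≤m

theorem5 :
    (lem : ExcludedMiddle 0ℓ) (ℛ : RealField) →
    let open RealField ℛ
        open Exponential lem ℛ
        open ParametricGraph ℛ
    in ∃ λ (C : ℝ) → 0# < C ×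
      ((n q : ℕ) → 2 ≤ᴺ n → 1 ≤ᴺ q →
       (G : WeightedDigraph n q) → Connected G →
       ∀ s t → Satisfiable (IsPath G {s} {t}) →
       (S : Pred ℝ 0ℓ) → (∀ x → x ∈ S → NoNegativeCycle G x) →
       ∃ λ 𝒮 → IsMSPC G s t S 𝒮 ×
         ι (length 𝒮) ≤ ι n ^ℝ (C * (log₂ (ι n) + log₂ (ι q))))
theorem5 lem ℛ = ι 14 , 0<14 , λ n q 2≤n 1≤q G _ s t path S no-cycle →
  let 1≤n = ℕₚ.≤-trans (s≤s z≤n) 2≤n
      k , 2ᵏ≤n , n<2ᵏ⁺¹ = floor-log₂ n 1≤n
      j , 2ʲ≤q , q<2ʲ⁺¹ = floor-log₂ q 1≤q
      open Walks lem ℛ G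
      -- One doubling more than the floor of log n, so that walks of up to 2^(k+1) > n edges include
      -- every path.
      𝒮 , 𝒮-cover , 𝒮≤ = small-cover path no-cycle (suc k) (ℕₚ.<⇒≤ n<2ᵏ⁺¹)
      𝒯 , 𝒯-mspc , 𝒯≤ = minimum-cover _ 𝒮 𝒮-cover 𝒮≤
  in 𝒯 , 𝒯-mspc , ≤-trans
       (ι-mono (ℕₚ.≤-trans 𝒯≤ (power-growth-bound j k 2≤n (growth-bound n q 2≤n 1≤q) 2ᵏ≤n n<2ᵏ⁺¹ q<2ʲ⁺¹)))
       (^-log₂-bound 14 j k 1≤n 2ᵏ≤n 2ʲ≤q)
  where
  open RealField ℛ using (ι; 0#; _<_)
  open OrderedField lem ℛ
  open Powers lem ℛ
  0<14 : 0# < ι 14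
  0<14 = <-≤-trans 0<1 (1≤ι {14} (s≤s z≤n))
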